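{- Let $n\geq 0$ be an integer and let $x$ be a complex number for which every denominator and every base raised to a negative power below is nonzero (this is the case whenever $x\notin\{0,\pm1,\pm\tfrac{1}{\sqrt2},\pm 2i,\pm i\sqrt2\}$). Then $$x\sum_{k=0}^{n-1}\binom{n}{k}\Bigl(\frac{\sqrt{x^2+4}\,(2x^3-x)}{x^2+2}\Bigr)^{n-k-1}\bigl(1-(-1)^{n-k}\bigr)T_{2k}(x)$$ $$=\bigl(2x\sqrt{x^2-1}\bigr)^{n-1}\sum_{k=1}^{n}\binom{n}{k}\Bigl(\frac{2x^2-1}{(x^3+2x)\sqrt{x^2-1}}\Bigr)^{k-1}\bigl(1+(-1)^{n-k}\bigr)F_{2k}(x)$$ and $$\frac12\sum_{k=0}^{n}\binom{n}{k}\Bigl(\frac{\sqrt{x^2+4}\,(2x^3-x)}{x^2+2}\Bigr)^{n-k-1}\bigl(1-(-1)^{n-k}\bigr)U_{2k}(x)$$ $$=\bigl(2x\sqrt{x^2-1}\bigr)^{n-2}\sum_{k=1}^{n}\binom{n}{k}\Bigl(\frac{2x^2-1}{(x^3+2x)\sqrt{x^2-1}}\Bigr)^{k-1}\bigl(\alpha(x)-(-1)^{n-k}\beta(x)\bigr)F_{2k}(x).$$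
   Context: The Chebyshev polynomials of the first kind $T_n(x)$ and of the second kind $U_n(x)$ are defined by $T_0(x)=1$, $T_1(x)=x$, $T_{n+1}(x)=2xT_n(x)-T_{n-1}(x)$, and $U_0(x)=1$, $U_1(x)=2x$, $U_{n+1}(x)=2xU_n(x)-U_{n-1}(x)$ for $n\ge 1$. The (Catalan) Fibonacci polynomials $F_n(x)$ are defined by $F_0(x)=0$, $F_1(x)=1$, $F_n(x)=xF_{n-1}(x)+F_{n-2}(x)$ for $n\geq 2$. Put $\alpha(x)=x+\sqrt{x^2-1}$ and $\beta(x)=x-\sqrt{x^2-1}$. Here $\sqrt{x^2-1}$ and $\sqrt{x^2+4}$ denote fixed complex square roots, the same choice being used throughout. Conventions: $0^0=1$, and a sum whose upper limit is smaller than its lower limit is $0$. -}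

module Defs where

open import Algebra.Apartness.Bundles using (HeytingField)
open import Algebra.Bundles using (CommutativeRing; Semiring)
open import Algebra.Definitions using (Invertible)
open import Algebra.Structures using (IsCommutativeRing)
open import Data.Fin.Base using (toℕ)
open import Data.Integer.Base using (ℤ; +_; -[1+_])
open import Data.Nat.Base as ℕ using (ℕ; zero; suc; _∸_)
import Data.Nat.Properties as ℕ
open import Data.Product.Base using (∃; _×_; _,_; proj₁; proj₂)
open import Data.Rational.Base as ℚ using (ℚ; 0ℚ; 1ℚ; ½; ∣_∣)
import Data.Rational.Properties as ℚ
open import Data.Sum.Base as Sum using (_⊎_; inj₁; inj₂; fromInj₁)
open import Function.Base using (_∘_)
open import Level using (0ℓ)
open import Relation.Binary.Definitions using (Tight)
open import Relation.Binary.Structures using (IsApartnessRelation; IsEquivalence)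
open import Relation.Binary.PropositionalEquality using (_≡_; _≢_; refl; sym; trans; cong; cong₂; subst)
open import Relation.Nullary.Decidable using (yes; no)
open import Relation.Nullary.Negation using (¬_; contradiction)

module Sequences where

  open import Data.Rational.Base using (_+_; _-_; _*_; -_; _<_; _≤_)
  open import Data.Rational.Solver using (module +-*-Solver)
  open +-*-Solver using (solve; _:=_; _:+_; _:-_; _:*_; :-_; con)

  Eventually : (ℕ → Set) → Set
  Eventually P = ∃ λ N → ∀ n → N ℕ.≤ n → P n

  Null : (ℕ → ℚ) → Set
  Null f = ∀ ε → 0ℚ < ε → Eventually λ n → ∣ f n ∣ < ε

  Cauchy : (ℕ → ℚ) → Set
  Cauchy f = ∀ ε → 0ℚ < ε → ∃ λ N → ∀ m n → N ℕ.≤ m → N ℕ.≤ n → ∣ f m - f n ∣ < ε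

  Bounded : (ℕ → ℚ) → Set
  Bounded f = ∃ λ M → 0ℚ < M × Eventually λ n → ∣ f n ∣ ≤ M

  Away : (ℕ → ℚ) → Set
  Away f = ∃ λ ε → 0ℚ < ε × Eventually λ n → ε ≤ ∣ f n ∣

  -- The value at 0 is immaterial.
  recip : ℚ → ℚ
  recip p with p ℚ.≟ 0ℚ
  ... | yes _  = 0ℚ
  ... | no p≢0 = (ℚ.1/ p) {{ℚ.≢-nonZero p≢0}}

  abstract

    lem₁ : ∀ a b → b + (a - b) ≡ a
    lem₁ = solve 2 (λ a b → b :+ (a :- b) := a) refl

    lem₂ : ∀ a b → a - b ≡ - (b - a)
    lem₂ = solve 2 (λ a b → a :- b := :- (b :- a)) refl

    lem₃ : ∀ a b c d → (a - b) + (c - d) ≡ (a + c) - (b + d)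
    lem₃ = solve 4 (λ a b c d → (a :- b) :+ (c :- d) := (a :+ c) :- (b :+ d)) refl

    lem₄ : ∀ a b → - (a - b) ≡ - a - - b
    lem₄ = solve 2 (λ a b → :- (a :- b) := (:- a) :- (:- b)) refl

    lem₅ : ∀ a b c d → a * (c - d) + d * (a - b) ≡ a * c - b * d
    lem₅ = solve 4 (λ a b c d → a :* (c :- d) :+ d :* (a :- b) := a :* c :- b :* d) refl

    lem₆ : ∀ p′ q′ p q → p′ * (q * q′) - q′ * (p * p′) ≡ p′ * (q′ * (q - p))
    lem₆ = solve 4 (λ p′ q′ p q → p′ :* (q :* q′) :- q′ :* (p :* p′) := p′ :* (q′ :* (q :- p))) refl

    lem₇ : ∀ a → a * a ≡ - a * - a
    lem₇ = solve 1 (λ a → a :* a := (:- a) :* (:- a)) refl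

    map : ∀ {P Q : ℕ → Set} → (∀ n → P n → Q n) → Eventually P → Eventually Q
    map f (N , p) = N , λ n N≤n → f n (p n N≤n)

    both : ∀ {P Q R : ℕ → Set} → (∀ n → P n → Q n → R n) → Eventually P → Eventually Q → Eventually R
    both f (M , p) (N , q) = M ℕ.⊔ N , λ n le →
      f n (p n (ℕ.≤-trans (ℕ.m≤m⊔n M N) le)) (q n (ℕ.≤-trans (ℕ.m≤n⊔m M N) le))

    half : ∀ {ε} → 0ℚ < ε → ∃ λ δ → 0ℚ < δ × δ + δ ≡ ε
    half {ε} ε>0 = ½ * ε
      , subst (_< ½ * ε) (ℚ.*-zeroʳ ½) (ℚ.*-monoʳ-<-pos ½ ε>0)
      , trans (sym (ℚ.*-distribʳ-+ ε ½ ½)) (ℚ.*-identityˡ ε)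

    recip-inverse : ∀ p → p ≢ 0ℚ → p * recip p ≡ 1ℚ
    recip-inverse p p≢0 with p ℚ.≟ 0ℚ
    ... | yes p≡0 = contradiction p≡0 p≢0
    ... | no p≢0₁ = ℚ.*-inverseʳ p {{ℚ.≢-nonZero p≢0₁}}

    *-pos : ∀ {p q} → 0ℚ < p → 0ℚ < q → 0ℚ < p * q
    *-pos {p} {q} p>0 q>0 = ℚ.positive⁻¹ (p * q)
      {{ℚ.pos*pos⇒pos p {{ℚ.positive p>0}} q {{ℚ.positive q>0}}}}

    pos⇒≢0 : ∀ {p} → 0ℚ < p → p ≢ 0ℚ
    pos⇒≢0 p>0 p≡0 = ℚ.<⇒≢ p>0 (sym p≡0)

    recip-pos : ∀ {p} → 0ℚ < p → 0ℚ < recip p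
    recip-pos {p} p>0 with p ℚ.≟ 0ℚ
    ... | yes p≡0 = contradiction p≡0 (pos⇒≢0 p>0)
    ... | no _    = ℚ.positive⁻¹ _ {{ℚ.1/pos⇒pos p {{ℚ.positive p>0}}}}

    quotient : ∀ {M ε} → 0ℚ < M → 0ℚ < ε → ∃ λ δ → 0ℚ < δ × M * δ ≡ ε
    quotient {M} {ε} M>0 ε>0 = recip M * ε , *-pos (recip-pos M>0) ε>0 ,
      trans (sym (ℚ.*-assoc M (recip M) ε))
        (trans (cong (_* ε) (recip-inverse M (pos⇒≢0 M>0))) (ℚ.*-identityˡ ε))

    *-mono : ∀ {p q r s} → 0ℚ ≤ p → 0ℚ ≤ s → p ≤ q → r ≤ s → p * r ≤ q * s
    *-mono {p} {q} {r} {s} p≥0 s≥0 p≤q r≤s = ℚ.≤-trans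
      (ℚ.*-monoˡ-≤-nonNeg p {{ℚ.nonNegative p≥0}} r≤s)
      (ℚ.*-monoʳ-≤-nonNeg s {{ℚ.nonNegative s≥0}} p≤q)

    small-+ : ∀ {p q δ ε} → ∣ p ∣ < δ → ∣ q ∣ < δ → δ + δ ≡ ε → ∣ p + q ∣ < ε
    small-+ {p} {q} p<δ q<δ refl = ℚ.≤-<-trans (ℚ.∣p+q∣≤∣p∣+∣q∣ p q) (ℚ.+-mono-< p<δ q<δ)

    small-* : ∀ {p q M δ ε} → 0ℚ < M → ∣ p ∣ ≤ M → ∣ q ∣ < δ → M * δ ≡ ε → ∣ p * q ∣ < ε
    small-* {p} {q} {M} {δ} M>0 p≤M q<δ refl = ℚ.≤-<-trans
      (subst (_≤ M * ∣ q ∣) (sym (ℚ.∣p*q∣≡∣p∣*∣q∣ p q))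
        (ℚ.*-monoʳ-≤-nonNeg ∣ q ∣ {{ℚ.∣-∣-nonNeg q}} p≤M))
      (ℚ.*-monoʳ-<-pos M {{ℚ.positive M>0}} q<δ)

    null-≗ : ∀ {f g} → (∀ n → f n ≡ g n) → Null f → Null g
    null-≗ f≗g null ε ε>0 = map (λ n → subst (λ p → ∣ p ∣ < ε) (f≗g n)) (null ε ε>0)

    null-0 : ∀ {f} → (∀ n → f n ≡ 0ℚ) → Null f
    null-0 f≗0 ε ε>0 = 0 , λ n _ → subst (λ p → ∣ p ∣ < ε) (sym (f≗0 n)) ε>0

    null-+ : ∀ {f g} → Null f → Null g → Null (λ n → f n + g n)
    null-+ nf ng ε ε>0 = let δ , δ>0 , eq = half ε>0 in
      both (λ n p q → small-+ p q eq) (nf δ δ>0) (ng δ δ>0)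

    null-neg : ∀ {f} → Null f → Null (λ n → - f n)
    null-neg {f} nf ε ε>0 = map (λ n → subst (_< ε) (sym (ℚ.∣-p∣≡∣p∣ (f n)))) (nf ε ε>0)

    null-* : ∀ {f g} → Bounded f → Null g → Null (λ n → f n * g n)
    null-* (M , M>0 , bf) ng ε ε>0 = let δ , δ>0 , eq = quotient M>0 ε>0 in
      both (λ n p q → small-* M>0 p q eq) bf (ng δ δ>0)

    p≤∣p∣ : ∀ p → p ≤ ∣ p ∣
    p≤∣p∣ p with ℚ.≤-total 0ℚ p
    ... | inj₁ 0≤p = ℚ.≤-reflexive (sym (ℚ.0≤p⇒∣p∣≡p 0≤p))
    ... | inj₂ p≤0 = ℚ.≤-trans p≤0 (ℚ.0≤∣p∣ p)

    ∣∣-≤ : ∀ p q → ∣ p ∣ ≤ ∣ q ∣ + ∣ p - q ∣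
    ∣∣-≤ p q = subst (λ r → ∣ r ∣ ≤ ∣ q ∣ + ∣ p - q ∣)
      (lem₁ p q) (ℚ.∣p+q∣≤∣p∣+∣q∣ q (p - q))

    ∣∣-swap : ∀ p q → ∣ p - q ∣ ≡ ∣ q - p ∣
    ∣∣-swap p q = trans (cong ∣_∣ (lem₂ p q)) (ℚ.∣-p∣≡∣p∣ (q - p))

    cauchy⇒bounded : ∀ {f} → Cauchy f → Bounded f
    cauchy⇒bounded {f} cf with cf 1ℚ (ℚ.positive⁻¹ 1ℚ)
    ... | N , close = ∣ f N ∣ + 1ℚ
      , ℚ.+-mono-≤-< (ℚ.0≤∣p∣ (f N)) (ℚ.positive⁻¹ 1ℚ)
      , N , λ n N≤n → ℚ.≤-trans (∣∣-≤ (f n) (f N))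
          (ℚ.+-monoʳ-≤ ∣ f N ∣ (ℚ.<⇒≤ (close n N N≤n ℕ.≤-refl)))

    cauchy-const : ∀ q → Cauchy (λ _ → q)
    cauchy-const q ε ε>0 = 0 , λ _ _ _ _ → subst (λ p → ∣ p ∣ < ε) (sym (ℚ.+-inverseʳ q)) ε>0

    cauchy-+ : ∀ {f g} → Cauchy f → Cauchy g → Cauchy (λ n → f n + g n)
    cauchy-+ {f} {g} cf cg ε ε>0 with half ε>0
    ... | δ , δ>0 , eq with cf δ δ>0 | cg δ δ>0
    ... | M , p | N , q = M ℕ.⊔ N , λ m n le₁ le₂ → subst (λ r → ∣ r ∣ < ε)
      (lem₃ (f m) (f n) (g m) (g n))
      (small-+ (p m n (ℕ.≤-trans (ℕ.m≤m⊔n M N) le₁) (ℕ.≤-trans (ℕ.m≤m⊔n M N) le₂))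
               (q m n (ℕ.≤-trans (ℕ.m≤n⊔m M N) le₁) (ℕ.≤-trans (ℕ.m≤n⊔m M N) le₂)) eq)

    cauchy-neg : ∀ {f} → Cauchy f → Cauchy (λ n → - f n)
    cauchy-neg {f} cf ε ε>0 with cf ε ε>0
    ... | N , p = N , λ m n le₁ le₂ → subst (_< ε)
      (trans (sym (ℚ.∣-p∣≡∣p∣ (f m - f n)))
        (cong ∣_∣ (lem₄ (f m) (f n))))
      (p m n le₁ le₂)

    cauchy-* : ∀ {f g} → Cauchy f → Cauchy g → Cauchy (λ n → f n * g n)
    cauchy-* {f} {g} cf cg ε ε>0 =
      let δ , δ>0 , eq = half ε>0
          A , A>0 , K , bf = cauchy⇒bounded {f} cf
          B , B>0 , L , bg = cauchy⇒bounded {g} cg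
          η , η>0 , eqA = quotient A>0 δ>0
          θ , θ>0 , eqB = quotient B>0 δ>0
          M , q = cg η η>0
          N , p = cf θ θ>0
          K≤ = ℕ.≤-trans (ℕ.m≤m⊔n K L) (ℕ.m≤m⊔n (K ℕ.⊔ L) (M ℕ.⊔ N))
          L≤ = ℕ.≤-trans (ℕ.m≤n⊔m K L) (ℕ.m≤m⊔n (K ℕ.⊔ L) (M ℕ.⊔ N))
          M≤ = ℕ.≤-trans (ℕ.m≤m⊔n M N) (ℕ.m≤n⊔m (K ℕ.⊔ L) (M ℕ.⊔ N))
          N≤ = ℕ.≤-trans (ℕ.m≤n⊔m M N) (ℕ.m≤n⊔m (K ℕ.⊔ L) (M ℕ.⊔ N))
      in (K ℕ.⊔ L) ℕ.⊔ (M ℕ.⊔ N) , λ m n le₁ le₂ →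
        subst (λ r → ∣ r ∣ < ε) (lem₅ (f m) (f n) (g m) (g n))
          (small-+ {f m * (g m - g n)} {g n * (f m - f n)} {δ} {ε}
            (small-* {f m} {g m - g n} {A} {η} {δ} A>0 (bf m (ℕ.≤-trans K≤ le₁))
              (q m n (ℕ.≤-trans M≤ le₁) (ℕ.≤-trans M≤ le₂)) eqA)
            (small-* {g n} {f m - f n} {B} {θ} {δ} B>0 (bg n (ℕ.≤-trans L≤ le₂))
              (p m n (ℕ.≤-trans N≤ le₁) (ℕ.≤-trans N≤ le₂)) eqB) eq)

    ≤∣∣⇒≢0 : ∀ {ε p} → 0ℚ < ε → ε ≤ ∣ p ∣ → p ≢ 0ℚ
    ≤∣∣⇒≢0 ε>0 le refl = ℚ.<-irrefl refl (ℚ.<-≤-trans ε>0 le)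

    ∣recip∣-≤ : ∀ {ε p} → 0ℚ < ε → ε ≤ ∣ p ∣ → ∣ recip p ∣ ≤ recip ε
    ∣recip∣-≤ {ε} {p} ε>0 le = ℚ.*-cancelˡ-≤-pos ε {{ℚ.positive ε>0}} (ℚ.≤-trans
      (ℚ.*-monoʳ-≤-nonNeg ∣ recip p ∣ {{ℚ.∣-∣-nonNeg (recip p)}} le)
      (ℚ.≤-reflexive (trans (sym (ℚ.∣p*q∣≡∣p∣*∣q∣ p (recip p)))
        (trans (cong ∣_∣ (recip-inverse p (≤∣∣⇒≢0 ε>0 le)))
          (sym (recip-inverse ε (pos⇒≢0 ε>0)))))))

    recip-- : ∀ p q → p ≢ 0ℚ → q ≢ 0ℚ → recip p - recip q ≡ recip p * (recip q * (q - p))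
    recip-- p q p≢0 q≢0 = trans
      (sym (cong₂ _-_ (trans (cong (recip p *_) (recip-inverse q q≢0)) (ℚ.*-identityʳ (recip p)))
                      (trans (cong (recip q *_) (recip-inverse p p≢0)) (ℚ.*-identityʳ (recip q)))))
      (lem₆ (recip p) (recip q) p q)

    cauchy-recip : ∀ {f} → Cauchy f → Away f → Cauchy (recip ∘ f)
    cauchy-recip {f} cf (α , α>0 , M , away) ε ε>0 with quotient (recip-pos α>0) ε>0
    ... | δ , δ>0 , eqδ with quotient (recip-pos α>0) δ>0
    ... | η , η>0 , eqη with cf η η>0
    ... | N , p = M ℕ.⊔ N , λ m n le₁ le₂ →
      let am = away m (ℕ.≤-trans (ℕ.m≤m⊔n M N) le₁)
          an = away n (ℕ.≤-trans (ℕ.m≤m⊔n M N) le₂)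
          close = p n m (ℕ.≤-trans (ℕ.m≤n⊔m M N) le₂) (ℕ.≤-trans (ℕ.m≤n⊔m M N) le₁)
      in subst (λ r → ∣ r ∣ < ε) (sym (recip-- (f m) (f n) (≤∣∣⇒≢0 α>0 am) (≤∣∣⇒≢0 α>0 an)))
           (small-* (recip-pos α>0) (∣recip∣-≤ α>0 am)
             (small-* (recip-pos α>0) (∣recip∣-≤ α>0 an) close eqη) eqδ)

    null-recip : ∀ {f} → Away f → Null (λ n → f n * recip (f n) - 1ℚ)
    null-recip {f} (α , α>0 , M , away) ε ε>0 = M , λ n le → subst (λ r → ∣ r ∣ < ε)
      (sym (trans (cong (_- 1ℚ) (recip-inverse (f n) (≤∣∣⇒≢0 α>0 (away n le)))) (ℚ.+-inverseʳ 1ℚ))) ε>0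

    null⇒¬away : ∀ {f} → Null f → ¬ Away f
    null⇒¬away {f} nf (ε , ε>0 , M , away) with nf ε ε>0
    ... | N , small = ℚ.<-irrefl refl
      (ℚ.<-≤-trans (small (M ℕ.⊔ N) (ℕ.m≤n⊔m M N)) (away (M ℕ.⊔ N) (ℕ.m≤m⊔n M N)))

    away-or-small : ∀ {f} → Cauchy f → ∀ ε → 0ℚ < ε → Away f ⊎ Eventually λ n → ∣ f n ∣ < ε
    away-or-small {f} cf ε ε>0 with half ε>0
    ... | δ , δ>0 , refl with half δ>0
    ... | η , η>0 , refl with cf η η>0
    ... | N , close with ∣ f N ∣ ℚ.<? δ
    ... | yes fN<δ = inj₂ (N , λ n le → ℚ.≤-<-trans (∣∣-≤ (f n) (f N))
            (ℚ.+-mono-< fN<δ (ℚ.<-trans (close n N le ℕ.≤-refl)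
              (subst (_< η + η) (ℚ.+-identityʳ η) (ℚ.+-monoʳ-< η η>0)))))
    ... | no fN≮δ = inj₁ (η , η>0 , N , λ n le → ℚ.≮⇒≥ λ fn<η →
            fN≮δ (ℚ.≤-<-trans (∣∣-≤ (f N) (f n)) (ℚ.+-mono-< fn<η (close N n ℕ.≤-refl le))))

    ¬away⇒null : ∀ {f} → Cauchy f → ¬ Away f → Null f
    ¬away⇒null cf ¬away ε ε>0 with away-or-small cf ε ε>0
    ... | inj₁ away  = contradiction away ¬away
    ... | inj₂ small = small

    away-+ : ∀ {f g} → Cauchy f → Cauchy g → Away (λ n → f n + g n) → Away f ⊎ Away g
    away-+ cf cg (ε , ε>0 , M , away) with half ε>0
    ... | δ , δ>0 , eq with away-or-small cf δ δ>0 | away-or-small cg δ δ>0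
    ... | inj₁ af | _       = inj₁ af
    ... | inj₂ _  | inj₁ ag = inj₂ ag
    ... | inj₂ sf | inj₂ sg with both (λ n p q → small-+ p q eq) sf sg
    ... | N , small = contradiction
      (ℚ.<-≤-trans (small (M ℕ.⊔ N) (ℕ.m≤n⊔m M N)) (away (M ℕ.⊔ N) (ℕ.m≤m⊔n M N)))
      (ℚ.<-irrefl refl)

    away-≗ : ∀ {f g} → (∀ n → f n ≡ g n) → Away f → Away g
    away-≗ f≗g (ε , ε>0 , away) = ε , ε>0 , map (λ n → subst (λ p → ε ≤ ∣ p ∣) (f≗g n)) away

    away-neg : ∀ {f} → Away f → Away (λ n → - f n)
    away-neg {f} (ε , ε>0 , away) = ε , ε>0 , map (λ n → subst (ε ≤_) (sym (ℚ.∣-p∣≡∣p∣ (f n)))) away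

    away-null : ∀ {f g} → Cauchy f → Cauchy g → Null (λ n → f n - g n) → Away f → Away g
    away-null {f} {g} cf cg null away = fromInj₁
      (λ away-diff → contradiction away-diff (null⇒¬away {λ n → f n - g n} null))
      (away-+ {g} {λ n → f n - g n} cg
        (cauchy-+ {f} {λ n → - g n} cf (cauchy-neg {g} cg))
        (away-≗ {f} {λ n → g n + (f n - g n)} (λ n → sym (lem₁ (f n) (g n))) away))

    away-*ˡ : ∀ {f g} → Bounded g → Away (λ n → f n * g n) → Away f
    away-*ˡ {f} {g} (M , M>0 , bg) (ε , ε>0 , away) with quotient M>0 ε>0
    ... | δ , δ>0 , refl = δ , δ>0 , both (λ n b a → ℚ.*-cancelˡ-≤-pos M {{ℚ.positive M>0}}
      (ℚ.≤-trans a (subst (_≤ M * ∣ f n ∣)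
        (sym (trans (ℚ.∣p*q∣≡∣p∣*∣q∣ (f n) (g n)) (ℚ.*-comm ∣ f n ∣ ∣ g n ∣)))
        (ℚ.*-monoʳ-≤-nonNeg ∣ f n ∣ {{ℚ.∣-∣-nonNeg (f n)}} b)))) bg away

    p*p≡∣p∣*∣p∣ : ∀ p → p * p ≡ ∣ p ∣ * ∣ p ∣
    p*p≡∣p∣*∣p∣ p with ℚ.∣p∣≡p∨∣p∣≡-p p
    ... | inj₁ eq = sym (cong (λ q → q * q) eq)
    ... | inj₂ eq = trans (lem₇ p) (sym (cong (λ q → q * q) eq))

    0≤p*p : ∀ p → 0ℚ ≤ p * p
    0≤p*p p = subst (0ℚ ≤_) (sym (p*p≡∣p∣*∣p∣ p))
      (*-mono {0ℚ} {∣ p ∣} {0ℚ} {∣ p ∣} ℚ.≤-refl (ℚ.0≤∣p∣ p) (ℚ.0≤∣p∣ p) (ℚ.0≤∣p∣ p))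

    square-≤ : ∀ {ε} p q → 0ℚ < ε → ε ≤ ∣ p ∣ → ε * ε ≤ ∣ p * p + q * q ∣
    square-≤ {ε} p q ε>0 le = ℚ.≤-trans {j = p * p}
      (subst (ε * ε ≤_) (sym (p*p≡∣p∣*∣p∣ p)) (*-mono {ε} {∣ p ∣} {ε} {∣ p ∣} (ℚ.<⇒≤ ε>0) (ℚ.0≤∣p∣ p) le le))
      (ℚ.≤-trans {j = p * p + q * q}
        (subst (_≤ p * p + q * q) (ℚ.+-identityʳ (p * p)) (ℚ.+-monoʳ-≤ (p * p) (0≤p*p q)))
        (p≤∣p∣ (p * p + q * q)))

    away-squares : ∀ {f g : ℕ → ℚ} → Away f → Away (λ n → f n * f n + g n * g n)
    away-squares {f} {g} (ε , ε>0 , away) =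
      ε * ε , *-pos ε>0 ε>0 , proj₁ away ,
      λ n N≤n → square-≤ (f n) (g n) ε>0 (proj₂ away n N≤n)

    away-1 : Away (λ _ → 1ℚ)
    away-1 = 1ℚ , ℚ.positive⁻¹ 1ℚ , 0 , λ _ _ → ℚ.≤-refl

    lem₈ : ∀ a b c → (a - b) + (b - c) ≡ a - c
    lem₈ = solve 3 (λ a b c → (a :- b) :+ (b :- c) := a :- c) refl

    lem₉ : ∀ a → - - a ≡ a
    lem₉ = solve 1 (λ a → :- :- a := a) refl

    assoc-re : ∀ a b c d e f →
      (a * c - b * d) * e - (a * d + b * c) * f ≡ a * (c * e - d * f) - b * (c * f + d * e)
    assoc-re = solve 6 (λ a b c d e f →
      (a :* c :- b :* d) :* e :- (a :* d :+ b :* c) :* f := a :* (c :* e :- d :* f) :- b :* (c :* f :+ d :* e)) refl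

    assoc-im : ∀ a b c d e f →
      (a * c - b * d) * f + (a * d + b * c) * e ≡ a * (c * f + d * e) + b * (c * e - d * f)
    assoc-im = solve 6 (λ a b c d e f →
      (a :* c :- b :* d) :* f :+ (a :* d :+ b :* c) :* e := a :* (c :* f :+ d :* e) :+ b :* (c :* e :- d :* f)) refl

    comm-re : ∀ a b c d → a * c - b * d ≡ c * a - d * b
    comm-re = solve 4 (λ a b c d → a :* c :- b :* d := c :* a :- d :* b) refl

    comm-im : ∀ a b c d → a * d + b * c ≡ c * b + d * a
    comm-im = solve 4 (λ a b c d → a :* d :+ b :* c := c :* b :+ d :* a) refl

    distribˡ-re : ∀ a b c d e f → a * (c + e) - b * (d + f) ≡ (a * c - b * d) + (a * e - b * f)
    distribˡ-re = solve 6 (λ a b c d e f →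
      a :* (c :+ e) :- b :* (d :+ f) := (a :* c :- b :* d) :+ (a :* e :- b :* f)) refl

    distribˡ-im : ∀ a b c d e f → a * (d + f) + b * (c + e) ≡ (a * d + b * c) + (a * f + b * e)
    distribˡ-im = solve 6 (λ a b c d e f →
      a :* (d :+ f) :+ b :* (c :+ e) := (a :* d :+ b :* c) :+ (a :* f :+ b :* e)) refl

    identity-re : ∀ a b → 1ℚ * a - 0ℚ * b ≡ a
    identity-re = solve 2 (λ a b → con 1ℚ :* a :- con 0ℚ :* b := a) refl

    identity-im : ∀ a b → 1ℚ * b + 0ℚ * a ≡ b
    identity-im = solve 2 (λ a b → con 1ℚ :* b :+ con 0ℚ :* a := b) refl

    inverse-re : ∀ a b r → a * (a * r) - b * (- b * r) ≡ (a * a + b * b) * r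
    inverse-re = solve 3 (λ a b r → a :* (a :* r) :- b :* (:- b :* r) := (a :* a :+ b :* b) :* r) refl

    inverse-im : ∀ a b r → a * (- b * r) + b * (a * r) ≡ 0ℚ
    inverse-im = solve 3 (λ a b r → a :* (:- b :* r) :+ b :* (a :* r) := con 0ℚ) refl

module Real where

  open Sequences

  record ℝ : Set where
    constructor mkℝ
    field
      seq    : ℕ → ℚ
      cauchy : Cauchy seq

  open ℝ public

  infix  4 _≈_ _#_
  infix  8 -_
  infixl 7 _*_
  infixl 6 _+_

  record _≈_ (x y : ℝ) : Set where
    constructor mk≈
    field
      null : Null λ n → seq x n ℚ.- seq y n

  record _#_ (x y : ℝ) : Set where
    constructor mk#
    field
      away : Away λ n → seq x n ℚ.- seq y n

  open _≈_ public
  open _#_ public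

  fromℚ : ℚ → ℝ
  fromℚ q = mkℝ (λ _ → q) (cauchy-const q)

  _+_ : ℝ → ℝ → ℝ
  x + y = mkℝ (λ n → seq x n ℚ.+ seq y n) (cauchy-+ {seq x} {seq y} (cauchy x) (cauchy y))

  _*_ : ℝ → ℝ → ℝ
  x * y = mkℝ (λ n → seq x n ℚ.* seq y n) (cauchy-* {seq x} {seq y} (cauchy x) (cauchy y))

  -_ : ℝ → ℝ
  - x = mkℝ (λ n → ℚ.- seq x n) (cauchy-neg {seq x} (cauchy x))

  0ℝ 1ℝ : ℝ
  0ℝ = fromℚ 0ℚ
  1ℝ = fromℚ 1ℚ

  abstract

    cauchy-- : ∀ x y → Cauchy λ n → seq x n ℚ.- seq y n
    cauchy-- x y = cauchy (x + (- y))

    ≗⇒≈ : ∀ {x y} → (∀ n → seq x n ≡ seq y n) → x ≈ y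
    ≗⇒≈ {x} {y} x≗y = mk≈ (null-0 λ n →
      trans (cong (ℚ._- seq y n) (x≗y n)) (ℚ.+-inverseʳ (seq y n)))

    ≈-refl : ∀ {x} → x ≈ x
    ≈-refl {x} = ≗⇒≈ {x} {x} λ _ → refl

    ≈-sym : ∀ {x y} → x ≈ y → y ≈ x
    ≈-sym {x} {y} (mk≈ p) = mk≈ (null-≗ {λ n → ℚ.- (seq x n ℚ.- seq y n)}
      (λ n → sym (lem₂ (seq y n) (seq x n))) (null-neg {λ n → seq x n ℚ.- seq y n} p))

    ≈-trans : ∀ {x y z} → x ≈ y → y ≈ z → x ≈ z
    ≈-trans {x} {y} {z} (mk≈ p) (mk≈ q) = mk≈
      (null-≗ {λ n → (seq x n ℚ.- seq y n) ℚ.+ (seq y n ℚ.- seq z n)}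
        (λ n → lem₈ (seq x n) (seq y n) (seq z n))
        (null-+ {λ n → seq x n ℚ.- seq y n} {λ n → seq y n ℚ.- seq z n} p q))

    +-cong : ∀ {x x′ y y′} → x ≈ x′ → y ≈ y′ → x + y ≈ x′ + y′
    +-cong {x} {x′} {y} {y′} (mk≈ p) (mk≈ q) = mk≈
      (null-≗ {λ n → (seq x n ℚ.- seq x′ n) ℚ.+ (seq y n ℚ.- seq y′ n)}
        (λ n → lem₃ (seq x n) (seq x′ n) (seq y n) (seq y′ n))
        (null-+ {λ n → seq x n ℚ.- seq x′ n} {λ n → seq y n ℚ.- seq y′ n} p q))

    neg-cong : ∀ {x x′} → x ≈ x′ → - x ≈ - x′
    neg-cong {x} {x′} (mk≈ p) = mk≈ (null-≗ {λ n → ℚ.- (seq x n ℚ.- seq x′ n)}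
      (λ n → lem₄ (seq x n) (seq x′ n)) (null-neg {λ n → seq x n ℚ.- seq x′ n} p))

    *-cong : ∀ {x x′ y y′} → x ≈ x′ → y ≈ y′ → x * y ≈ x′ * y′
    *-cong {x} {x′} {y} {y′} (mk≈ p) (mk≈ q) = mk≈
      (null-≗ {λ n → seq x n ℚ.* (seq y n ℚ.- seq y′ n) ℚ.+ seq y′ n ℚ.* (seq x n ℚ.- seq x′ n)}
        (λ n → lem₅ (seq x n) (seq x′ n) (seq y n) (seq y′ n))
        (null-+ {λ n → seq x n ℚ.* (seq y n ℚ.- seq y′ n)} {λ n → seq y′ n ℚ.* (seq x n ℚ.- seq x′ n)}
          (null-* {seq x} {λ n → seq y n ℚ.- seq y′ n} (cauchy⇒bounded {seq x} (cauchy x)) q)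
          (null-* {seq y′} {λ n → seq x n ℚ.- seq x′ n} (cauchy⇒bounded {seq y′} (cauchy y′)) p)))

    #-irrefl : ∀ {x y} → x ≈ y → ¬ x # y
    #-irrefl {x} {y} (mk≈ p) (mk# q) = null⇒¬away {λ n → seq x n ℚ.- seq y n} p q

    #-sym : ∀ {x y} → x # y → y # x
    #-sym {x} {y} (mk# p) = mk# (away-≗ {λ n → ℚ.- (seq x n ℚ.- seq y n)}
      (λ n → sym (lem₂ (seq y n) (seq x n))) (away-neg {λ n → seq x n ℚ.- seq y n} p))

    #-cotrans : ∀ {x y} → x # y → ∀ z → x # z ⊎ z # y
    #-cotrans {x} {y} (mk# p) z = Sum.map mk# mk#
      (away-+ {λ n → seq x n ℚ.- seq z n} {λ n → seq z n ℚ.- seq y n} (cauchy-- x z) (cauchy-- z y)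
        (away-≗ {λ n → seq x n ℚ.- seq y n}
          (λ n → sym (lem₈ (seq x n) (seq z n) (seq y n))) p))

    ¬#⇒≈ : ∀ {x y} → ¬ x # y → x ≈ y
    ¬#⇒≈ {x} {y} ¬p = mk≈ (¬away⇒null {λ n → seq x n ℚ.- seq y n} (cauchy-- x y) (¬p ∘ mk#))

  recipℝ : ∀ x → Away (seq x) → ℝ
  recipℝ x p = mkℝ (recip ∘ seq x) (cauchy-recip {seq x} (cauchy x) p)

  recipℝ-inverse : ∀ x p → x * recipℝ x p ≈ 1ℝ
  recipℝ-inverse x p = mk≈ (null-recip {seq x} p)

module Complex where

  open Sequences
  open Real using (ℝ; seq; cauchy; 0ℝ; 1ℝ; mk≈; mk#; null; away)
  private module R = Real

  infix 3 _+i_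

  record ℂ : Set where
    constructor _+i_
    field
      re im : ℝ

  open ℂ public

  infix  4 _≈_ _#_
  infix  8 -_
  infixl 7 _*_
  infixl 6 _+_

  record _≈_ (z w : ℂ) : Set where
    constructor _,_
    field
      re≈ : re z R.≈ re w
      im≈ : im z R.≈ im w

  -- The constructive reading of z ≠ w: tight, hence classically the negation of _≈_.
  data _#_ (z w : ℂ) : Set where
    re# : re z R.# re w → z # w
    im# : im z R.# im w → z # w

  open _≈_

  _+_ : ℂ → ℂ → ℂ
  z + w = (re z R.+ re w) +i (im z R.+ im w)

  _*_ : ℂ → ℂ → ℂ
  z * w = (re z R.* re w R.+ (R.- (im z R.* im w))) +i (re z R.* im w R.+ im z R.* re w)

  -_ : ℂ → ℂ
  - z = (R.- re z) +i (R.- im z)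

  fromℚ : ℚ → ℂ
  fromℚ q = R.fromℚ q +i 0ℝ

  0ℂ 1ℂ i : ℂ
  0ℂ = fromℚ 0ℚ
  1ℂ = fromℚ 1ℚ
  i  = 0ℝ +i 1ℝ

  abstract

    ≗⇒≈ : ∀ {z w} → (∀ n → seq (re z) n ≡ seq (re w) n) → (∀ n → seq (im z) n ≡ seq (im w) n) → z ≈ w
    ≗⇒≈ p q = R.≗⇒≈ p , R.≗⇒≈ q

    ≈-isEquivalence : IsEquivalence _≈_
    ≈-isEquivalence = record
      { refl  = R.≈-refl , R.≈-refl
      ; sym   = λ (p , q) → R.≈-sym p , R.≈-sym q
      ; trans = λ (p , q) (p′ , q′) → R.≈-trans p p′ , R.≈-trans q q′
      }

    +-cong : ∀ {z z′ w w′} → z ≈ z′ → w ≈ w′ → z + w ≈ z′ + w′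
    +-cong (p , q) (p′ , q′) = R.+-cong p p′ , R.+-cong q q′

    *-cong : ∀ {z z′ w w′} → z ≈ z′ → w ≈ w′ → z * w ≈ z′ * w′
    *-cong (p , q) (p′ , q′) =
      R.+-cong (R.*-cong p p′) (R.neg-cong (R.*-cong q q′)) , R.+-cong (R.*-cong p q′) (R.*-cong q p′)

    neg-cong : ∀ {z z′} → z ≈ z′ → - z ≈ - z′
    neg-cong (p , q) = R.neg-cong p , R.neg-cong q

    +-assoc : ∀ z w v → z + w + v ≈ z + (w + v)
    +-assoc z w v = ≗⇒≈
      (λ n → ℚ.+-assoc (seq (re z) n) (seq (re w) n) (seq (re v) n))
      (λ n → ℚ.+-assoc (seq (im z) n) (seq (im w) n) (seq (im v) n))

    +-comm : ∀ z w → z + w ≈ w + z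
    +-comm z w = ≗⇒≈
      (λ n → ℚ.+-comm (seq (re z) n) (seq (re w) n))
      (λ n → ℚ.+-comm (seq (im z) n) (seq (im w) n))

    +-identityˡ : ∀ z → 0ℂ + z ≈ z
    +-identityˡ z = ≗⇒≈ (λ n → ℚ.+-identityˡ (seq (re z) n)) (λ n → ℚ.+-identityˡ (seq (im z) n))

    +-inverseˡ : ∀ z → - z + z ≈ 0ℂ
    +-inverseˡ z = ≗⇒≈ (λ n → ℚ.+-inverseˡ (seq (re z) n)) (λ n → ℚ.+-inverseˡ (seq (im z) n))

    *-assoc : ∀ z w v → z * w * v ≈ z * (w * v)
    *-assoc z w v = ≗⇒≈
      (λ n → assoc-re (seq (re z) n) (seq (im z) n) (seq (re w) n) (seq (im w) n) (seq (re v) n) (seq (im v) n))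
      (λ n → assoc-im (seq (re z) n) (seq (im z) n) (seq (re w) n) (seq (im w) n) (seq (re v) n) (seq (im v) n))

    *-comm : ∀ z w → z * w ≈ w * z
    *-comm z w = ≗⇒≈
      (λ n → comm-re (seq (re z) n) (seq (im z) n) (seq (re w) n) (seq (im w) n))
      (λ n → comm-im (seq (re z) n) (seq (im z) n) (seq (re w) n) (seq (im w) n))

    *-identityˡ : ∀ z → 1ℂ * z ≈ z
    *-identityˡ z = ≗⇒≈
      (λ n → identity-re (seq (re z) n) (seq (im z) n))
      (λ n → identity-im (seq (re z) n) (seq (im z) n))

    *-distribˡ-+ : ∀ z w v → z * (w + v) ≈ z * w + z * v
    *-distribˡ-+ z w v = ≗⇒≈
      (λ n → distribˡ-re (seq (re z) n) (seq (im z) n) (seq (re w) n) (seq (im w) n) (seq (re v) n) (seq (im v) n))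
      (λ n → distribˡ-im (seq (re z) n) (seq (im z) n) (seq (re w) n) (seq (im w) n) (seq (re v) n) (seq (im v) n))

  private module E = IsEquivalence ≈-isEquivalence

  isCommutativeRing : IsCommutativeRing _≈_ _+_ _*_ -_ 0ℂ 1ℂ
  isCommutativeRing = record
    { isRing = record
      { +-isAbelianGroup = record
        { isGroup = record
          { isMonoid = record
            { isSemigroup = record
              { isMagma = record { isEquivalence = ≈-isEquivalence ; ∙-cong = +-cong }
              ; assoc = +-assoc
              }
            ; identity = +-identityˡ , λ z → E.trans (+-comm z 0ℂ) (+-identityˡ z)
            }
          ; inverse = +-inverseˡ , λ z → E.trans (+-comm z (- z)) (+-inverseˡ z)
          ; ⁻¹-cong = neg-cong
          }
        ; comm = +-comm
        }
      ; *-cong = *-cong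
      ; *-assoc = *-assoc
      ; *-identity = *-identityˡ , λ z → E.trans (*-comm z 1ℂ) (*-identityˡ z)
      ; distrib = *-distribˡ-+ , λ z w v →
          E.trans (*-comm (w + v) z) (E.trans (*-distribˡ-+ z w v) (+-cong (*-comm z w) (*-comm z v)))
      }
    ; *-comm = *-comm
    }

  -- 1 / (a + bi) = (a - bi) / (a² + b²)
  inverse : ∀ z → Away (seq (re z R.* re z R.+ im z R.* im z)) → ℂ
  inverse z p = (re z R.* r) +i ((R.- im z) R.* r)
    where
    r : ℝ
    r = R.recipℝ (re z R.* re z R.+ im z R.* im z) p

  abstract

    *-inverseʳ : ∀ z p → z * inverse z p ≈ 1ℂ
    *-inverseʳ z p =
      R.≈-trans
        (R.≗⇒≈ λ n → inverse-re (seq (re z) n) (seq (im z) n) (recip (seq N n)))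
        (R.recipℝ-inverse N p)
      , R.≗⇒≈ λ n → inverse-im (seq (re z) n) (seq (im z) n) (recip (seq N n))
      where
      N : ℝ
      N = re z R.* re z R.+ im z R.* im z

    norm-away : ∀ {z w} → z # w →
      let d = z + - w in Away (seq (re d R.* re d R.+ im d R.* im d))
    norm-away {z} {w} (re# (mk# p)) =
      away-squares {seq (re (z + - w))} {seq (im (z + - w))} p
    norm-away {z} {w} (im# (mk# p)) =
      let d = z + - w in
      away-≗
        {λ n → seq (im d) n ℚ.* seq (im d) n ℚ.+ seq (re d) n ℚ.* seq (re d) n}
        {λ n → seq (re d) n ℚ.* seq (re d) n ℚ.+ seq (im d) n ℚ.* seq (im d) n}
        (λ n → ℚ.+-comm (seq (im d) n ℚ.* seq (im d) n) (seq (re d) n ℚ.* seq (re d) n))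
        (away-squares {seq (im d)} {seq (re d)} p)

    invertible⇒# : ∀ {z w} → Invertible _≈_ 1ℂ _*_ (z + - w) → z # w
    invertible⇒# {z} {w} (v , _ , d*v≈1) = Sum.[ re# ∘ mk# ∘ toAway (re d) (re v) , im# ∘ mk# ∘ toAway (im d) (im v) ∘ unneg ]′
      (away-+ {seq (re d R.* re v)} {seq (R.- (im d R.* im v))}
        (cauchy (re d R.* re v)) (cauchy (R.- (im d R.* im v)))
        (away-null {λ _ → 1ℚ} {seq (re (d * v))} (cauchy 1ℝ) (cauchy (re (d * v)))
          (null (R.≈-sym (re≈ d*v≈1))) away-1))
      where
      d : ℂ
      d = z + - w
      toAway : ∀ x y → Away (seq (x R.* y)) → Away (seq x)
      toAway x y = away-*ˡ {seq x} {seq y} (cauchy⇒bounded {seq y} (cauchy y))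
      unneg : Away (seq (R.- (im d R.* im v))) → Away (seq (im d R.* im v))
      unneg p = away-≗ {λ n → ℚ.- (ℚ.- (seq (im d R.* im v) n))}
        (λ n → lem₉ (seq (im d R.* im v) n)) (away-neg {seq (R.- (im d R.* im v))} p)

  #⇒invertible : ∀ {z w} → z # w → Invertible _≈_ 1ℂ _*_ (z + - w)
  #⇒invertible {z} {w} p = v , E.trans (*-comm v (z + - w)) (*-inverseʳ (z + - w) (norm-away p)) , *-inverseʳ (z + - w) (norm-away p)
    where
    v : ℂ
    v = inverse (z + - w) (norm-away p)

  abstract

    #-isApartnessRelation : IsApartnessRelation _≈_ _#_
    #-isApartnessRelation = record
      { irrefl = λ { (p , q) (re# r) → R.#-irrefl p r ; (p , q) (im# r) → R.#-irrefl q r }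
      ; sym = λ { (re# p) → re# (R.#-sym p) ; (im# p) → im# (R.#-sym p) }
      ; cotrans = λ
        { (re# p) v → Sum.map re# re# (R.#-cotrans p (re v))
        ; (im# p) v → Sum.map im# im# (R.#-cotrans p (im v))
        }
      }

    #-tight : Tight _≈_ _#_
    #-tight z w =
        (λ ¬p → R.¬#⇒≈ (¬p ∘ re#) , R.¬#⇒≈ (¬p ∘ im#))
      , IsApartnessRelation.irrefl #-isApartnessRelation

  ℂ-heytingField : HeytingField 0ℓ 0ℓ 0ℓ
  ℂ-heytingField = record
    { isHeytingField = record
      { isHeytingCommutativeRing = record
        { isCommutativeRing   = isCommutativeRing
        ; isApartnessRelation = #-isApartnessRelation
        ; #⇒invertible        = #⇒invertible
        ; invertible⇒#        = invertible⇒#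
        }
      ; tight = #-tight
      }
    }

module Field {c ℓ₁ ℓ₂} (K : HeytingField c ℓ₁ ℓ₂) where

  open HeytingField K
  private
    commutativeRing : CommutativeRing c ℓ₁
    commutativeRing = record { isCommutativeRing = isCommutativeRing }
    module CR = CommutativeRing commutativeRing

  open import Algebra.Definitions.RawSemiring (Semiring.rawSemiring CR.semiring) public
    using (_^_) renaming (_×_ to _·_; sum to ∑)

  fromℕ : ℕ → Carrier
  fromℕ n = n · 1#

  -- `#⇒invertible` inverts x - 0#.
  inv : ∀ x → x # 0# → Carrier
  inv x x#0 = proj₁ (#⇒invertible x#0)

  infixl 7 _/_[_]
  infixr 8 _^ᶻ_[_]

  _/_[_] : ∀ (x y : Carrier) → y # 0# → Carrier
  x / y [ y#0 ] = x * inv y y#0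

  _^ᶻ_[_] : ∀ x → ℤ → x # 0# → Carrier
  x ^ᶻ + n      [ x#0 ] = x ^ n
  x ^ᶻ -[1+ n ] [ x#0 ] = inv x x#0 ^ suc n

  -- Half-open range, so that an upper limit n - 1 needs no special case at n = 0.
  ∑-range : ℕ → ℕ → (ℕ → Carrier) → Carrier
  ∑-range a b f = ∑ {b ∸ a} λ j → f (a ℕ.+ toℕ j)

  infixl 6.5 ∑-range
  syntax ∑-range a b (λ k → e) = ∑[ a ≤ k < b ] e

  T U F : ℕ → Carrier → Carrier

  T 0 x             = 1#
  T 1 x             = x
  T (suc (suc n)) x = fromℕ 2 * x * T (suc n) x - T n x

  U 0 x             = 1#
  U 1 x             = fromℕ 2 * x
  U (suc (suc n)) x = fromℕ 2 * x * U (suc n) x - U n x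

  F 0 x             = 0#
  F 1 x             = 1#
  F (suc (suc n)) x = x * F (suc n) x + F n x

  -- Here s stands for √(x² - 1).
  α β : (x s : Carrier) → Carrier
  α x s = x + s
  β x s = x - s

  -- With s = √(x² - 1) and t = √(x² + 4): the denominators and the bases raised to
  -- a possibly negative power are nonzero. The base 2xs occurs with a negative exponent
  -- only for n < 2, but it is nonzero as soon as (x³ + 2x)s is.
  record Admissible (x s t : Carrier) : Set ℓ₂ where
    field
      x²+2#0     : x ^ 2 + fromℕ 2 # 0#
      [x³+2x]s#0 : (x ^ 3 + fromℕ 2 * x) * s # 0#

    P : Carrier
    P = t * (fromℕ 2 * x ^ 3 - x) / (x ^ 2 + fromℕ 2) [ x²+2#0 ]

    Q : Carrier
    Q = (fromℕ 2 * x ^ 2 - 1#) / ((x ^ 3 + fromℕ 2 * x) * s) [ [x³+2x]s#0 ]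

    field
      P#0   : P # 0#
      2xs#0 : fromℕ 2 * x * s # 0#

{-# OPTIONS --safe #-}
-- Put A = α², B = β², Φ = φ², Ψ = ψ² with φ, ψ = (x ± t) / 2, and D = 2xs. By Binet's formulas
-- and the binomial theorem, both sides of each identity become combinations of n-th powers,
-- and those powers agree one by one because
--   A + P = D (Q Φ + 1),  B + P = D (Q Φ - 1),  A - P = D (Q Ψ + 1),  B - P = D (Q Ψ - 1).
-- The first identity is compared after multiplication by 2 P = x D Q t, the second after
-- multiplication by 4 s P = D² Q t; this absorbs all negative exponents.

module Submission where

open import Algebra.Apartness.Bundles using (HeytingCommutativeRing; HeytingField)
open import Algebra.Bundles using (CommutativeRing)
open import Data.Integer.Base using (_⊖_)
open import Data.Nat.Base using (ℕ; suc; _∸_) renaming (_*_ to _*ℕ_)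
open import Data.Nat.Combinatorics using (_C_)
open import Data.Product.Base using (_×_; _,_; proj₁; proj₂)
open import Data.Rational.Base using (½)
open import Defs
import Algebra.Apartness.Properties.HeytingCommutativeRing as HeytingProperties
import Algebra.Properties.CommutativeSemiring.Binomial as Binomial
import Algebra.Properties.CommutativeSemiring.Exp as CommutativeExp
import Algebra.Properties.Ring as RingProperties
import Algebra.Properties.Semiring.Exp as Exp
import Algebra.Properties.Semiring.Mult as Mult
import Algebra.Properties.Semiring.Sum as Sum
import Algebra.Solver.Ring as RingSolver
open import Algebra.Solver.Ring.AlmostCommutativeRing using (AlmostCommutativeRing; _-Raw-AlmostCommutative⟶_)
open import Data.Fin.Base using (toℕ)
open import Data.Fin.Properties using (toℕ<n)
open import Data.Integer.Base as ℤ using (ℤ; +_; -[1+_])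
import Data.Integer.Properties as ℤ
open import Data.Maybe.Base using (Maybe; just; nothing)
open import Data.Nat.Base as ℕ using (zero; _≤_; z≤n; s≤s)
import Data.Nat.Properties as ℕ
import Data.Sign.Base as Sign
import Relation.Binary.Reasoning.Setoid as SetoidReasoning
import Relation.Binary.PropositionalEquality as ≡
open import Relation.Nullary.Decidable using (yes; no)

-- A ring solver with integer coefficients over a commutative ring.

module IntegerSolver {c ℓ} (R : CommutativeRing c ℓ) where

  open CommutativeRing R hiding (zero)
  open RingProperties ring using (-‿distribˡ-*; -‿distribʳ-*; -‿+-comm; -‿involutive; -0#≈0#)
  open Mult semiring using (×-homo-+; ×1-homo-*) renaming (_×_ to _·_)
  open SetoidReasoning setoid

  -- The clause for 1 makes con (+ 1) denote 1# itself, while con (+ 2) denotes 2 · 1#.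
  ⟦_⟧ⁿ : ℕ → Carrier
  ⟦ 1 ⟧ⁿ = 1#
  ⟦ n ⟧ⁿ = n · 1#

  ⟦_⟧ᶻ : ℤ → Carrier
  ⟦ + n ⟧ᶻ      = ⟦ n ⟧ⁿ
  ⟦ -[1+ n ] ⟧ᶻ = - ⟦ suc n ⟧ⁿ

  ⟦n⟧≈n·1 : ∀ n → ⟦ n ⟧ⁿ ≈ n · 1#
  ⟦n⟧≈n·1 0             = refl
  ⟦n⟧≈n·1 1             = sym (+-identityʳ 1#)
  ⟦n⟧≈n·1 (suc (suc n)) = refl

  +-homoⁿ : ∀ m n → ⟦ m ℕ.+ n ⟧ⁿ ≈ ⟦ m ⟧ⁿ + ⟦ n ⟧ⁿ
  +-homoⁿ m n = begin
    ⟦ m ℕ.+ n ⟧ⁿ      ≈⟨ ⟦n⟧≈n·1 (m ℕ.+ n) ⟩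
    (m ℕ.+ n) · 1#    ≈⟨ ×-homo-+ 1# m n ⟩
    m · 1# + n · 1#   ≈⟨ +-cong (⟦n⟧≈n·1 m) (⟦n⟧≈n·1 n) ⟨
    ⟦ m ⟧ⁿ + ⟦ n ⟧ⁿ   ∎

  *-homoⁿ : ∀ m n → ⟦ m ℕ.* n ⟧ⁿ ≈ ⟦ m ⟧ⁿ * ⟦ n ⟧ⁿ
  *-homoⁿ m n = begin
    ⟦ m ℕ.* n ⟧ⁿ        ≈⟨ ⟦n⟧≈n·1 (m ℕ.* n) ⟩
    (m ℕ.* n) · 1#      ≈⟨ ×1-homo-* m n ⟩
    (m · 1#) * (n · 1#) ≈⟨ *-cong (⟦n⟧≈n·1 m) (⟦n⟧≈n·1 n) ⟨
    ⟦ m ⟧ⁿ * ⟦ n ⟧ⁿ     ∎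

  +-cancel-1 : ∀ x y → (1# + x) - (1# + y) ≈ x - y
  +-cancel-1 x y = begin
    (1# + x) - (1# + y)       ≈⟨ +-congˡ (-‿+-comm 1# y) ⟨
    (1# + x) + (- 1# + - y)   ≈⟨ +-congʳ (+-comm 1# x) ⟩
    (x + 1#) + (- 1# + - y)   ≈⟨ +-assoc x 1# _ ⟩
    x + (1# + (- 1# + - y))   ≈⟨ +-congˡ (+-assoc 1# (- 1#) (- y)) ⟨
    x + ((1# + - 1#) + - y)   ≈⟨ +-congˡ (+-congʳ (-‿inverseʳ 1#)) ⟩
    x + (0# + - y)            ≈⟨ +-congˡ (+-identityˡ (- y)) ⟩
    x - y                     ∎

  -- Lowering both arguments by one leaves `m ⊖ n` unchanged; `+-cancel-1` is the same cancellation
  -- in the ring.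
  ⊖-homo : ∀ m n → ⟦ m ⊖ n ⟧ᶻ ≈ ⟦ m ⟧ⁿ - ⟦ n ⟧ⁿ
  ⊖-homo zero    zero    = sym (-‿inverseʳ 0#)
  ⊖-homo zero    (suc n) = sym (+-identityˡ _)
  ⊖-homo (suc m) zero    = sym (trans (+-congˡ -0#≈0#) (+-identityʳ _))
  ⊖-homo (suc m) (suc n) rewrite ℤ.[1+m]⊖[1+n]≡m⊖n m n = begin
    ⟦ m ⊖ n ⟧ᶻ                   ≈⟨ ⊖-homo m n ⟩
    ⟦ m ⟧ⁿ - ⟦ n ⟧ⁿ              ≈⟨ +-cancel-1 _ _ ⟨
    (1# + ⟦ m ⟧ⁿ) - (1# + ⟦ n ⟧ⁿ) ≈⟨ +-cong (+-homoⁿ 1 m) (-‿cong (+-homoⁿ 1 n)) ⟨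
    ⟦ suc m ⟧ⁿ - ⟦ suc n ⟧ⁿ      ∎

  +-homo : ∀ i j → ⟦ i ℤ.+ j ⟧ᶻ ≈ ⟦ i ⟧ᶻ + ⟦ j ⟧ᶻ
  +-homo (+ m)    (+ n)    = +-homoⁿ m n
  +-homo (+ m)    -[1+ n ] = ⊖-homo m (suc n)
  +-homo -[1+ m ] (+ n)    = trans (⊖-homo n (suc m)) (+-comm _ _)
  +-homo -[1+ m ] -[1+ n ] = begin
    - ⟦ suc (suc (m ℕ.+ n)) ⟧ⁿ    ≈⟨ -‿cong (reflexive (≡.cong (λ k → ⟦ suc k ⟧ⁿ) (ℕ.+-suc m n))) ⟨
    - ⟦ suc m ℕ.+ suc n ⟧ⁿ        ≈⟨ -‿cong (+-homoⁿ (suc m) (suc n)) ⟩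
    - (⟦ suc m ⟧ⁿ + ⟦ suc n ⟧ⁿ)   ≈⟨ -‿+-comm _ _ ⟨
    - ⟦ suc m ⟧ⁿ + - ⟦ suc n ⟧ⁿ   ∎

  -- Products of integers of opposite sign compute to `Sign.- ◃ n`, which is `+ 0` rather than a
  -- negative numeral when `n` is zero.
  -◃-homo : ∀ n → ⟦ Sign.- ℤ.◃ n ⟧ᶻ ≈ - ⟦ n ⟧ⁿ
  -◃-homo zero    = sym -0#≈0#
  -◃-homo (suc n) = refl

  *-homo : ∀ i j → ⟦ i ℤ.* j ⟧ᶻ ≈ ⟦ i ⟧ᶻ * ⟦ j ⟧ᶻ
  *-homo (+ m)    (+ n)    = trans (reflexive (≡.cong ⟦_⟧ᶻ (ℤ.+◃n≡+n (m ℕ.* n)))) (*-homoⁿ m n)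
  *-homo (+ m)    -[1+ n ] = trans (-◃-homo (m ℕ.* suc n))
    (trans (-‿cong (*-homoⁿ m (suc n))) (-‿distribʳ-* _ _))
  *-homo -[1+ m ] (+ n)    = trans (-◃-homo (suc m ℕ.* n))
    (trans (-‿cong (*-homoⁿ (suc m) n)) (-‿distribˡ-* _ _))
  *-homo -[1+ m ] -[1+ n ] = begin
    ⟦ suc m ℕ.* suc n ⟧ⁿ              ≈⟨ *-homoⁿ (suc m) (suc n) ⟩
    ⟦ suc m ⟧ⁿ * ⟦ suc n ⟧ⁿ           ≈⟨ -‿involutive _ ⟨
    - - (⟦ suc m ⟧ⁿ * ⟦ suc n ⟧ⁿ)     ≈⟨ -‿cong (-‿distribˡ-* _ _) ⟩
    - (- ⟦ suc m ⟧ⁿ * ⟦ suc n ⟧ⁿ)     ≈⟨ -‿distribʳ-* _ _ ⟩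
    - ⟦ suc m ⟧ⁿ * - ⟦ suc n ⟧ⁿ       ∎

  neg-homo : ∀ i → ⟦ ℤ.- i ⟧ᶻ ≈ - ⟦ i ⟧ᶻ
  neg-homo (+ zero)  = sym -0#≈0#
  neg-homo (+ suc n) = refl
  neg-homo -[1+ n ]  = sym (-‿involutive _)

  almostCommutativeRing : AlmostCommutativeRing c ℓ
  almostCommutativeRing = record
    { isAlmostCommutativeRing = record
      { isCommutativeSemiring = isCommutativeSemiring
      ; -‿cong                = -‿cong
      ; -‿*-distribˡ          = λ x y → sym (-‿distribˡ-* x y)
      ; -‿+-comm              = -‿+-comm
      }
    }

  morphism : CommutativeRing.rawRing ℤ.+-*-commutativeRing -Raw-AlmostCommutative⟶ almostCommutativeRing
  morphism = record
    { ⟦_⟧    = ⟦_⟧ᶻ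
    ; +-homo = +-homo
    ; *-homo = *-homo
    ; -‿homo = neg-homo
    ; 0-homo = refl
    ; 1-homo = refl
    }

  -- Distinct integers can denote the same ring element in positive characteristic, so unequal
  -- coefficients decide nothing.
  coefficient≟ : ∀ i j → Maybe (⟦ i ⟧ᶻ ≈ ⟦ j ⟧ᶻ)
  coefficient≟ i j with i ℤ.≟ j
  ... | yes i≡j = just (reflexive (≡.cong ⟦_⟧ᶻ i≡j))
  ... | no  _   = nothing

  open RingSolver _ almostCommutativeRing morphism coefficient≟ public
    using (solve; con; _:=_; _:+_; _:-_; _:*_; _:^_; :-_)

-- Binomial sums with alternating weights, and second-order linear recurrences.

module BinomialSums {c ℓ} (R : CommutativeRing c ℓ) where

  open CommutativeRing R hiding (zero)
  open IntegerSolver R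
  open Exp semiring using (_^_; ^-congˡ)
  open CommutativeExp commutativeSemiring using (^-distrib-*)
  open Mult semiring using (×-congʳ; ×-assoc-*) renaming (_×_ to _·_)
  open Sum semiring using (sum; sum-cong-≋; ∑-distrib-+; *-distribˡ-sum)
  open SetoidReasoning setoid

  -- Reduction modulo the relation `l ≈ r`: `z` is the cofactor of `l - r`, and the last premise is
  -- typically a polynomial identity left to the ring solver. Nested uses reduce modulo several
  -- relations.
  modulo : ∀ {l r a b} z → l ≈ r → a ≈ b + z * (l - r) → a ≈ b
  modulo {l} {r} {a} {b} z l≈r a≈ = begin
    a                ≈⟨ a≈ ⟩
    b + z * (l - r)  ≈⟨ +-congˡ (*-congˡ (+-congʳ l≈r)) ⟩
    b + z * (r - r)  ≈⟨ solve 3 (λ b z r → b :+ z :* (r :- r) := b) refl b z r ⟩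
    b                ∎

  [-x]^n : ∀ x n → (- x) ^ n ≈ x ^ n * (- 1#) ^ n
  [-x]^n x n = begin
    (- x) ^ n          ≈⟨ ^-congˡ n (solve 1 (λ x → :- x := x :* :- con (+ 1)) refl x) ⟩
    (x * - 1#) ^ n     ≈⟨ ^-distrib-* x (- 1#) n ⟩
    x ^ n * (- 1#) ^ n ∎

  -- The coefficient is written as a ring factor `m · 1#` because that is what `fromℕ (n C k)`
  -- unfolds to in the sums to be evaluated.
  binomial-theorem : ∀ n u p →
    sum {suc n} (λ k → (n C toℕ k) · 1# * (p ^ (n ∸ toℕ k) * u ^ toℕ k)) ≈ (u + p) ^ n
  binomial-theorem n u p = sym (trans (Binomial.theorem commutativeSemiring n u p)
    (sum-cong-≋ {suc n} λ k → let m = n C toℕ k in begin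
      m · (u ^ toℕ k * p ^ (n ∸ toℕ k))         ≈⟨ ×-congʳ m (trans (*-comm _ _) (sym (*-identityˡ _))) ⟩
      m · (1# * (p ^ (n ∸ toℕ k) * u ^ toℕ k))  ≈⟨ ×-assoc-* m 1# _ ⟨
      m · 1# * (p ^ (n ∸ toℕ k) * u ^ toℕ k)    ∎))

  sum-linear : ∀ {n} a b f g → a * sum {n} f + b * sum g ≈ sum λ k → a * f k + b * g k
  sum-linear a b f g = trans (+-cong (*-distribˡ-sum a f) (*-distribˡ-sum b g))
    (sym (∑-distrib-+ (λ k → a * f k) (λ k → b * g k)))

  -- The sign is absorbed by (- p)^(n - k) = p^(n - k) (- 1)^(n - k), so each term splits into four
  -- binomial terms, with bases `u` and `v` shifted by `p` or by `- p`. The multiplier `κ` is there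
  -- to clear the denominators of `τ`.
  binomial-sum : ∀ n κ e f p g h u v (τ : ℕ → Carrier) →
    (∀ k → k ≤ n → κ * τ k ≈
      (n C k) · 1# * (p ^ (n ∸ k) * (e + f * (- 1#) ^ (n ∸ k))) * (g * u ^ k + h * v ^ k)) →
    κ * sum {suc n} (λ k → τ (toℕ k)) ≈
      e * (g * (u + p) ^ n + h * (v + p) ^ n) + f * (g * (u - p) ^ n + h * (v - p) ^ n)
  binomial-sum n κ e f p g h u v τ τ≈ = begin
    κ * sum {suc n} (λ k → τ (toℕ k))         ≈⟨ *-distribˡ-sum {suc n} κ (λ k → τ (toℕ k)) ⟩
    sum {suc n} (λ k → κ * τ (toℕ k))         ≈⟨ sum-cong-≋ {suc n} term ⟩
    sum (λ k → e * (g * b p u k + h * b p v k) + f * (g * b (- p) u k + h * b (- p) v k))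
      ≈⟨ sum-linear e f (λ k → g * b p u k + h * b p v k) (λ k → g * b (- p) u k + h * b (- p) v k) ⟨
    e * sum (λ k → g * b p u k + h * b p v k) + f * sum (λ k → g * b (- p) u k + h * b (- p) v k)
      ≈⟨ +-cong (*-congˡ (pair p)) (*-congˡ (pair (- p))) ⟩
    e * (g * (u + p) ^ n + h * (v + p) ^ n) + f * (g * (u - p) ^ n + h * (v - p) ^ n) ∎
    where
    b = λ q w k → (n C toℕ {suc n} k) · 1# * (q ^ (n ∸ toℕ k) * w ^ toℕ k)

    pair : ∀ q → sum (λ k → g * b q u k + h * b q v k) ≈ g * (u + q) ^ n + h * (v + q) ^ n
    pair q = trans (sym (sum-linear g h (b q u) (b q v)))
      (+-cong (*-congˡ (binomial-theorem n u q)) (*-congˡ (binomial-theorem n v q)))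

    term : ∀ k → κ * τ (toℕ k) ≈ e * (g * b p u k + h * b p v k) + f * (g * b (- p) u k + h * b (- p) v k)
    term k = begin
      κ * τ (toℕ k)  ≈⟨ τ≈ (toℕ k) (ℕ.s≤s⁻¹ (toℕ<n k)) ⟩
      N * (y * (e + f * ε)) * (g * U + h * V)
        ≈⟨ solve 9 (λ N y e f ε g h U V →
             N :* (y :* (e :+ f :* ε)) :* (g :* U :+ h :* V) :=
             e :* (g :* (N :* (y :* U)) :+ h :* (N :* (y :* V)))
               :+ f :* (g :* (N :* (y :* ε :* U)) :+ h :* (N :* (y :* ε :* V))))
             refl N y e f ε g h U V ⟩
      e * (g * b p u k + h * b p v k) + f * (g * (N * (y * ε * U)) + h * (N * (y * ε * V)))
        ≈⟨ +-congˡ (*-congˡ (+-cong (*-congˡ (*-congˡ (*-congʳ neg))) (*-congˡ (*-congˡ (*-congʳ neg))))) ⟨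
      e * (g * b p u k + h * b p v k) + f * (g * b (- p) u k + h * b (- p) v k) ∎
      where
      N = (n C toℕ k) · 1#
      y = p ^ (n ∸ toℕ k)
      ε = (- 1#) ^ (n ∸ toℕ k)
      U = u ^ toℕ k
      V = v ^ toℕ k
      neg = [-x]^n p (n ∸ toℕ k)

  -- `sum` unfolds at its first index, so the last term is reached by induction with `τ` shifted by
  -- one.
  sum-drop-last : ∀ n (τ : ℕ → Carrier) → τ n ≈ 0# → sum {n} (λ k → τ (toℕ k)) ≈ sum {suc n} (λ k → τ (toℕ k))
  sum-drop-last zero    τ τn≈0 = sym (trans (+-identityʳ _) τn≈0)
  sum-drop-last (suc n) τ τn≈0 = +-congˡ (sum-drop-last n (λ k → τ (suc k)) τn≈0)

  sum-drop-first : ∀ n (τ : ℕ → Carrier) → τ 0 ≈ 0# → sum {n} (λ k → τ (suc (toℕ k))) ≈ sum {suc n} (λ k → τ (toℕ k))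
  sum-drop-first n τ τ0≈0 = sym (trans (+-congʳ τ0≈0) (+-identityˡ _))

  -- Since `r` and `q` are roots of X² = cX + d, both sides obey the same recurrence and two initial
  -- values determine them. The factor `κ` keeps the formula free of division.
  binet : ∀ {c d κ y z r q} (w : ℕ → Carrier) → (∀ m → w (2 ℕ.+ m) ≈ c * w (1 ℕ.+ m) + d * w m) →
    r ^ 2 ≈ c * r + d → q ^ 2 ≈ c * q + d →
    κ * w 0 ≈ y + z → κ * w 1 ≈ y * r + z * q →
    ∀ m → κ * w m ≈ y * r ^ m + z * q ^ m
  binet {c} {d} {κ} {y} {z} {r} {q} w rec r² q² w₀ w₁ m = proj₁ (both m)
    where
    G : ℕ → Carrier
    G m = y * r ^ m + z * q ^ m

    G-rec : ∀ m → c * G (1 ℕ.+ m) + d * G m ≈ G (2 ℕ.+ m)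
    -- The two sides differ by y r^m times the equation of `r` plus z q^m times the equation of `q`,
    -- up to sign.
    G-rec m = modulo (- (z * q ^ m)) q² (modulo (- (y * r ^ m)) r²
      (solve 8 (λ c d y z r q R Q →
        c :* (y :* (r :* R) :+ z :* (q :* Q)) :+ d :* (y :* R :+ z :* Q) :=
        ((y :* (r :* (r :* R)) :+ z :* (q :* (q :* Q))) :+ :- (z :* Q) :* (q :^ 2 :- (c :* q :+ d)))
          :+ :- (y :* R) :* (r :^ 2 :- (c :* r :+ d))) refl c d y z r q (r ^ m) (q ^ m)))

    both : ∀ m → κ * w m ≈ G m × κ * w (suc m) ≈ G (suc m)
    both zero    = trans w₀ (sym (+-cong (*-identityʳ y) (*-identityʳ z)))
                 , trans w₁ (sym (+-cong (*-congˡ (*-identityʳ r)) (*-congˡ (*-identityʳ q))))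
    both (suc m) = let p₀ , p₁ = both m in p₁ , (begin
      κ * w (2 ℕ.+ m)                   ≈⟨ *-congˡ (rec m) ⟩
      κ * (c * w (1 ℕ.+ m) + d * w m)   ≈⟨ solve 5 (λ κ c d a b → κ :* (c :* a :+ d :* b) := c :* (κ :* a) :+ d :* (κ :* b))
             refl κ c d _ _ ⟩
      c * (κ * w (1 ℕ.+ m)) + d * (κ * w m) ≈⟨ +-cong (*-congˡ p₁) (*-congˡ p₀) ⟩
      c * G (1 ℕ.+ m) + d * G m         ≈⟨ G-rec m ⟩
      G (2 ℕ.+ m)                       ∎)

-- Apartness from zero, inverses and integer powers.

module FieldProperties {c ℓ₁ ℓ₂} (K : HeytingField c ℓ₁ ℓ₂) where

  open HeytingField K using (_#_; #⇒invertible; heytingCommutativeRing)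
  open HeytingCommutativeRing heytingCommutativeRing using (commutativeRing)
  open CommutativeRing commutativeRing hiding (zero)
  open HeytingProperties heytingCommutativeRing
    using (x-0≈x; #-congʳ; invertibleˡ⇒#; x#0y#0→xy#0)
  open Field K
  open IntegerSolver commutativeRing
  open SetoidReasoning setoid

  inv-inverseʳ : ∀ {x} (x#0 : x # 0#) → x * inv x x#0 ≈ 1#
  inv-inverseʳ {x} x#0 = trans (*-congʳ (sym (x-0≈x x))) (proj₂ (proj₂ (#⇒invertible x#0)))

  *≈1⇒#0 : ∀ {x y} → x * y ≈ 1# → x # 0#
  *≈1⇒#0 {x} {y} xy≈1 = invertibleˡ⇒# (y , trans (trans (*-congˡ (x-0≈x x)) (*-comm y x)) xy≈1)

  inv#0 : ∀ {x} (x#0 : x # 0#) → inv x x#0 # 0#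
  inv#0 x#0 = *≈1⇒#0 (trans (*-comm _ _) (inv-inverseʳ x#0))

  -- `y` times the inverse of `x * y` is an inverse of `x`.
  *#0⇒#0ˡ : ∀ {x y} → x * y # 0# → x # 0#
  *#0⇒#0ˡ xy#0 = *≈1⇒#0 (trans (sym (*-assoc _ _ _)) (inv-inverseʳ xy#0))

  *#0⇒#0ʳ : ∀ {x y} → x * y # 0# → y # 0#
  *#0⇒#0ʳ xy#0 = *#0⇒#0ˡ (#-congʳ (*-comm _ _) xy#0)

  #⇒-#0 : ∀ {x y} → x # y → x - y # 0#
  #⇒-#0 x#y = *≈1⇒#0 (proj₂ (proj₂ (#⇒invertible x#y)))

  *-cancelˡ-# : ∀ {x y z} → x # 0# → x * y ≈ x * z → y ≈ z
  *-cancelˡ-# {x} {y} {z} x#0 xy≈xz = begin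
    y                    ≈⟨ undo y ⟩
    inv x x#0 * (x * y)  ≈⟨ *-congˡ xy≈xz ⟩
    inv x x#0 * (x * z)  ≈⟨ undo z ⟨
    z                    ∎
    where
    undo : ∀ w → w ≈ inv x x#0 * (x * w)
    undo w = begin
      w                    ≈⟨ *-identityˡ w ⟨
      1# * w               ≈⟨ *-congʳ (inv-inverseʳ x#0) ⟨
      x * inv x x#0 * w    ≈⟨ *-congʳ (*-comm x _) ⟩
      inv x x#0 * x * w    ≈⟨ *-assoc _ _ _ ⟩
      inv x x#0 * (x * w)  ∎

  -- For `k ≤ n` the exponent n - k - 1 is at least -1, and it is -1 only at k = n; a single factor
  -- `x` therefore makes every exponent natural.
  ^-⊖-suc : ∀ x (x#0 : x # 0#) {n k} → k ≤ n → x * x ^ᶻ (n ⊖ suc k) [ x#0 ] ≈ x ^ (n ∸ k)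
  ^-⊖-suc x x#0 {zero}  z≤n = trans (*-congˡ (*-identityʳ _)) (inv-inverseʳ x#0)
  ^-⊖-suc x x#0 {suc n} z≤n = refl
  ^-⊖-suc x x#0 {suc n} {suc k} (s≤s k≤n) rewrite ℤ.[1+m]⊖[1+n]≡m⊖n n (suc k) = ^-⊖-suc x x#0 k≤n

  -- The exponent n - 2 is at least -2, so two factors suffice; from n = 1 on, one of them is
  -- handled by `^-⊖-suc`.
  ^-⊖2 : ∀ x (x#0 : x # 0#) n → x * x * x ^ᶻ (n ⊖ 2) [ x#0 ] ≈ x ^ n
  ^-⊖2 x x#0 zero = begin
    x * x * (y * (y * 1#))  ≈⟨ solve 2 (λ x y → x :* x :* (y :* (y :* con (+ 1))) := (x :* y) :* (x :* y))
           refl x y ⟩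
    x * y * (x * y)         ≈⟨ *-cong (inv-inverseʳ x#0) (inv-inverseʳ x#0) ⟩
    1# * 1#                 ≈⟨ *-identityˡ 1# ⟩
    1#                      ∎
    where y = inv x x#0
  ^-⊖2 x x#0 (suc n) rewrite ℤ.[1+m]⊖[1+n]≡m⊖n n 1 =
    trans (*-assoc _ _ _) (*-congˡ (^-⊖-suc x x#0 {n} z≤n))

-- Binet's formulas for the Chebyshev and Fibonacci polynomials.

module ChebyshevFibonacci {c ℓ₁ ℓ₂} (K : HeytingField c ℓ₁ ℓ₂) where

  open HeytingField K hiding (zero)
  open Field K
  open FieldProperties K
  open HeytingCommutativeRing heytingCommutativeRing using (commutativeRing)
  open CommutativeRing commutativeRing using (semiring; commutativeSemiring)
  open HeytingProperties heytingCommutativeRing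
    using (#-congʳ; x#0y#0→xy#0)
  open BinomialSums commutativeRing
  open IntegerSolver commutativeRing
  open Exp semiring using (^-congˡ; ^-assocʳ)
  open CommutativeExp commutativeSemiring using (^-distrib-*)
  open SetoidReasoning setoid

  -- One half enters as an element `h` with its defining equation, because a Heyting field may have
  -- characteristic 2.
  module Identities (h : Carrier) (2h≈1 : fromℕ 2 * h ≈ 1#)
    (x s t : Carrier) (s² : s ^ 2 ≈ x ^ 2 - 1#) (t² : t ^ 2 ≈ x ^ 2 + fromℕ 4) where

    φ ψ : Carrier
    φ = h * (x + t)
    ψ = h * (x - t)

    2#0 : fromℕ 2 # 0#
    2#0 = *≈1⇒#0 2h≈1

    -- The square root is quantified anew: `- s` in place of `s` turns α into β, so one computation
    -- serves both roots of X² = 2xX - 1.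
    x+s-root : ∀ s → s ^ 2 ≈ x ^ 2 - 1# → (x + s) ^ 2 ≈ fromℕ 2 * x * (x + s) + - 1#
    x+s-root s s² = modulo 1# s² (solve 2 (λ x s →
      (x :+ s) :^ 2 := (con (+ 2) :* x :* (x :+ s) :+ :- con (+ 1)) :+ con (+ 1) :* (s :^ 2 :- (x :^ 2 :- con (+ 1))))
      refl x s)

    -- X² = xX + 1 is the characteristic equation of the recurrence for `F`; `- t` in place of `t`
    -- turns `φ` into `ψ`.
    h[x+t]-root : ∀ t → t ^ 2 ≈ x ^ 2 + fromℕ 4 → (h * (x + t)) ^ 2 ≈ x * (h * (x + t)) + 1#
    -- Once t² is replaced, the two sides differ by (2h - 1)(hx(x + t) + 2h + 1), which gives the
    -- second cofactor.
    h[x+t]-root t t² = modulo (h ^ 2) t² (modulo (h * x * (x + t) + fromℕ 2 * h + 1#) 2h≈1 (solve 3 (λ x t h →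
      (h :* (x :+ t)) :^ 2 := ((x :* (h :* (x :+ t)) :+ con (+ 1)) :+ h :^ 2 :* (t :^ 2 :- (x :^ 2 :+ con (+ 4))))
        :+ (h :* x :* (x :+ t) :+ con (+ 2) :* h :+ con (+ 1)) :* (con (+ 2) :* h :- con (+ 1)))
      refl x t h))

    neg² : ∀ y {z} → y ^ 2 ≈ z → (- y) ^ 2 ≈ z
    neg² y = trans (solve 1 (λ y → (:- y) :^ 2 := y :^ 2) refl y)

    rec-TU : ∀ a b → fromℕ 2 * x * a - b ≈ fromℕ 2 * x * a + - 1# * b
    rec-TU = solve 3 (λ x a b → con (+ 2) :* x :* a :- b := con (+ 2) :* x :* a :+ :- con (+ 1) :* b) refl x

    T-binet : ∀ m → fromℕ 2 * T m x ≈ 1# * α x s ^ m + 1# * β x s ^ m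
    T-binet = binet (λ m → T m x) (λ m → rec-TU _ _) (x+s-root s s²) (x+s-root (- s) (neg² s s²))
      (solve 0 (con (+ 2) :* con (+ 1) := con (+ 1) :+ con (+ 1)) refl)
      (solve 2 (λ x s → con (+ 2) :* x := con (+ 1) :* (x :+ s) :+ con (+ 1) :* (x :- s)) refl x s)

    -- One power of each root in α^(m+1) - β^(m+1) is kept as a coefficient; these coefficients
    -- become the weights α and - β on the right side of the second identity.
    U-binet : ∀ m → fromℕ 2 * s * U m x ≈ α x s * α x s ^ m + - β x s * β x s ^ m
    U-binet = binet (λ m → U m x) (λ m → rec-TU _ _) (x+s-root s s²) (x+s-root (- s) (neg² s s²))
      (solve 2 (λ x s → con (+ 2) :* s :* con (+ 1) := (x :+ s) :+ :- (x :- s)) refl x s)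
      (solve 2 (λ x s → con (+ 2) :* s :* (con (+ 2) :* x) := (x :+ s) :* (x :+ s) :+ :- (x :- s) :* (x :- s))
             refl x s)

    F-binet : ∀ m → t * F m x ≈ 1# * φ ^ m + - 1# * ψ ^ m
    F-binet = binet (λ m → F m x) (λ m → +-congˡ (sym (*-identityˡ _))) (h[x+t]-root t t²) (h[x+t]-root (- t) (neg² t t²))
      (solve 1 (λ t → t :* con (+ 0) := con (+ 1) :+ :- con (+ 1)) refl t)
      (modulo (- t) 2h≈1 (solve 3 (λ x t h → t :* con (+ 1) :=
        (con (+ 1) :* (h :* (x :+ t)) :+ :- con (+ 1) :* (h :* (x :- t))) :+ :- t :* (con (+ 2) :* h :- con (+ 1)))
        refl x t h))

    -- The sums involve even indices only, so the roots enter through their squares `A`, `B`, `Φ`,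
    -- `Ψ`.
    even-binet : ∀ {κ g u h v} (w : ℕ → Carrier) → (∀ m → κ * w m ≈ g * u ^ m + h * v ^ m) →
      ∀ k → κ * w (2 *ℕ k) ≈ g * (u ^ 2) ^ k + h * (v ^ 2) ^ k
    even-binet w w≈ k = trans (w≈ (2 *ℕ k))
      (+-cong (*-congˡ (sym (^-assocʳ _ 2 k))) (*-congˡ (sym (^-assocʳ _ 2 k))))

    -- The common powers, and the evaluation of both kinds of sums.

    module _ (admissible : Admissible x s t) where

      open Admissible admissible

      -- `E` is the product `D * Q` after cancelling `x * s`. Being free of `s` and `t`, it stays
      -- fixed when `shifted-squares` is used with `- s` or `- t`.
      D r E A B Φ Ψ : Carrier
      D = fromℕ 2 * x * s
      r = inv (x ^ 2 + fromℕ 2) x²+2#0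
      E = fromℕ 2 * (fromℕ 2 * x ^ 2 - 1#) * r
      A = α x s ^ 2
      B = β x s ^ 2
      Φ = φ ^ 2
      Ψ = ψ ^ 2

      D*Q≈E : D * Q ≈ E
      D*Q≈E = begin
        D * Q
          ≈⟨ *-identityʳ _ ⟨
        D * Q * 1#
          -- The inserted factor x² + 2 completes `x * s` to the denominator (x³ + 2x)s of `Q`,
          -- which then cancels.
          ≈⟨ *-congˡ (inv-inverseʳ x²+2#0) ⟨
        D * Q * ((x ^ 2 + fromℕ 2) * r)
          ≈⟨ solve 5 (λ x s q w r →
               con (+ 2) :* x :* s :* (q :* w) :* ((x :^ 2 :+ con (+ 2)) :* r) :=
               con (+ 2) :* (q :* ((x :^ 3 :+ con (+ 2) :* x) :* s :* w)) :* r) refl x s q w r ⟩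
        fromℕ 2 * (q * ((x ^ 3 + fromℕ 2 * x) * s * w)) * r
          ≈⟨ *-congʳ (*-congˡ (trans (*-congˡ (inv-inverseʳ [x³+2x]s#0)) (*-identityʳ q))) ⟩
        E ∎
        where
        q = fromℕ 2 * x ^ 2 - 1#
        w = inv ((x ^ 3 + fromℕ 2 * x) * s) [x³+2x]s#0

      -- Replacing s by - s and t by - t yields the four identities that match the binomial powers.
      shifted-squares : ∀ s t → s ^ 2 ≈ x ^ 2 - 1# → t ^ 2 ≈ x ^ 2 + fromℕ 4 →
        (x + s) ^ 2 + t * (fromℕ 2 * x ^ 3 - x) * r ≈ E * (h * (x + t)) ^ 2 + fromℕ 2 * x * s
      shifted-squares s t s² t² =
        -- With t² replaced, the term E (h(x + t))² becomes 4h²qv. Then 4h² = 1 and (x² + 2)r = 1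
        -- leave q + xtqr, and q = 2x² - 1 equals x² + s².
        modulo (- (E * h ^ 2)) t² (modulo 1# s² (modulo (- q) (inv-inverseʳ x²+2#0)
          (modulo (- (q * (fromℕ 2 * h + 1#) * v)) 2h≈1
            (solve 5 (λ x s t r h →
              let q = con (+ 2) :* x :^ 2 :- con (+ 1)
                  E = con (+ 2) :* q :* r
                  v = r :* (x :^ 2 :+ con (+ 2)) :+ r :* (x :* t)
              in
              (x :+ s) :^ 2 :+ t :* (con (+ 2) :* x :^ 3 :- x) :* r :=
              (((E :* (h :* (x :+ t)) :^ 2 :+ con (+ 2) :* x :* s)
                :+ :- (E :* h :^ 2) :* (t :^ 2 :- (x :^ 2 :+ con (+ 4))))
                :+ con (+ 1) :* (s :^ 2 :- (x :^ 2 :- con (+ 1))))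
                :+ (:- q) :* ((x :^ 2 :+ con (+ 2)) :* r :- con (+ 1))
                :+ :- (q :* (con (+ 2) :* h :+ con (+ 1)) :* v) :* (con (+ 2) :* h :- con (+ 1)))
              refl x s t r h))))
        where
        q = fromℕ 2 * x ^ 2 - 1#
        v = r * (x ^ 2 + fromℕ 2) + r * (x * t)

      A+P : A + P ≈ D * (Q * Φ + 1#)
      A+P = trans (shifted-squares s t s² t²) (trans (+-congʳ (*-congʳ (sym D*Q≈E)))
        (solve 3 (λ d q f → d :* q :* f :+ d := d :* (q :* f :+ con (+ 1))) refl D Q Φ))

      B+P : B + P ≈ D * (Q * Φ - 1#)
      B+P = trans (shifted-squares (- s) t (neg² s s²) t²) (trans (+-congʳ (*-congʳ (sym D*Q≈E)))
        (solve 4 (λ x s q f → con (+ 2) :* x :* s :* q :* f :+ con (+ 2) :* x :* :- s :=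
          con (+ 2) :* x :* s :* (q :* f :- con (+ 1))) refl x s Q Φ))

      -- `P` is odd in `t`, so its subtraction is the case `- t` of `shifted-squares`.
      -P≈ : ∀ a → a - P ≈ a + - t * (fromℕ 2 * x ^ 3 - x) * r
      -P≈ = solve 4 (λ t y r a → a :- t :* y :* r := a :+ :- t :* y :* r) refl t (fromℕ 2 * x ^ 3 - x) r

      A-P : A - P ≈ D * (Q * Ψ + 1#)
      A-P = trans (-P≈ A) (trans (shifted-squares s (- t) s² (neg² t t²)) (trans (+-congʳ (*-congʳ (sym D*Q≈E)))
        (solve 3 (λ d q f → d :* q :* f :+ d := d :* (q :* f :+ con (+ 1))) refl D Q Ψ)))

      B-P : B - P ≈ D * (Q * Ψ - 1#)
      B-P = trans (-P≈ B) (trans (shifted-squares (- s) (- t) (neg² s s²) (neg² t t²)) (trans (+-congʳ (*-congʳ (sym D*Q≈E)))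
        (solve 4 (λ x s q f → con (+ 2) :* x :* s :* q :* f :+ con (+ 2) :* x :* :- s :=
          con (+ 2) :* x :* s :* (q :* f :- con (+ 1))) refl x s Q Ψ)))

      -- This relates the multiplier `P` that clears the left sums to the multipliers `D` and
      -- `Q * t` of the right sums. It holds because D Q = E and x (2x² - 1) = 2x³ - x.
      xDQt≈2P : x * (D * (Q * t)) ≈ fromℕ 2 * P
      xDQt≈2P = begin
        x * (D * (Q * t))  ≈⟨ solve 4 (λ x d q t → x :* (d :* (q :* t)) := x :* (d :* q) :* t) refl x D Q t ⟩
        x * (D * Q) * t    ≈⟨ *-congʳ (*-congˡ D*Q≈E) ⟩
        x * E * t          ≈⟨ solve 3 (λ x t r → x :* (con (+ 2) :* (con (+ 2) :* x :^ 2 :- con (+ 1)) :* r) :* t :=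
                                con (+ 2) :* (t :* (con (+ 2) :* x :^ 3 :- x) :* r)) refl x t r ⟩
        fromℕ 2 * P        ∎

      -- `P` lifts the exponent n - k - 1 to n - k, and `κ` is the factor in Binet's formula for
      -- `w`. The weight 1 - (- 1)^(n - k) is the case e = 1, f = - 1 of `binomial-sum`.
      P-sum : ∀ n {κ g h} (w : ℕ → Carrier) → (∀ k → κ * w k ≈ g * A ^ k + h * B ^ k) →
        κ * P * (∑[ 0 ≤ k < suc n ] fromℕ (n C k) * P ^ᶻ (n ⊖ suc k) [ P#0 ] * (1# - (- 1#) ^ (n ∸ k)) * w k) ≈
        1# * (g * (A + P) ^ n + h * (B + P) ^ n) + - 1# * (g * (A - P) ^ n + h * (B - P) ^ n)
      P-sum n {κ} {g} {h} w w≈ = binomial-sum n (κ * P) 1# (- 1#) P g h A B _ λ k k≤n →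
        let N = fromℕ (n C k); z = P ^ᶻ (n ⊖ suc k) [ P#0 ]; ε = (- 1#) ^ (n ∸ k) in begin
        κ * P * (N * z * (1# - ε) * w k)
          ≈⟨ solve 6 (λ κ P N z ε w → κ :* P :* (N :* z :* (con (+ 1) :- ε) :* w) :=
               N :* (P :* z :* (con (+ 1) :+ :- con (+ 1) :* ε)) :* (κ :* w)) refl κ P N z ε (w k) ⟩
        N * (P * z * (1# + - 1# * ε)) * (κ * w k)
          ≈⟨ *-cong (*-congˡ (*-congʳ (^-⊖-suc P P#0 k≤n))) (w≈ k) ⟩
        N * (P ^ (n ∸ k) * (1# + - 1# * ε)) * (g * A ^ k + h * B ^ k) ∎

      -- At k = 0 the exponent `k ∸ 1` is truncated to 0, but there F_0 = 0 makes both sides vanish.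
      Q-power : ∀ k → Q * (Q ^ (k ∸ 1) * F (2 *ℕ k) x) ≈ Q ^ k * F (2 *ℕ k) x
      Q-power zero    = solve 1 (λ q → q :* (con (+ 1) :* con (+ 0)) := con (+ 1) :* con (+ 0)) refl Q
      Q-power (suc k) = sym (*-assoc _ _ _)

      -- `binomial-sum` with `p` equal to 1 yields n-th powers of Q Φ ± 1 and Q Ψ ± 1; the factor
      -- D^n turns them into powers of A ± P and B ± P. The general weight `δ` covers both
      -- identities.
      Q-sum : ∀ n e f (δ : ℕ → Carrier) → (∀ m → δ m ≈ e + f * (- 1#) ^ m) →
        D ^ n * (Q * t * (∑[ 1 ≤ k < suc n ] fromℕ (n C k) * Q ^ (k ∸ 1) * δ (n ∸ k) * F (2 *ℕ k) x)) ≈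
        e * ((A + P) ^ n - (A - P) ^ n) + f * ((B + P) ^ n - (B - P) ^ n)
      Q-sum n e f δ δ≈ = begin
        D ^ n * (Q * t * (∑[ 1 ≤ k < suc n ] τ k))
          -- The term k = 0 added here is zero because F_0 = 0.
          ≈⟨ *-congˡ (*-congˡ (sum-drop-first n τ (zeroʳ _))) ⟩
        D ^ n * (Q * t * (∑[ 0 ≤ k < suc n ] τ k))
          ≈⟨ *-congˡ (binomial-sum n (Q * t) e f 1# 1# (- 1#) (Q * Φ) (Q * Ψ) τ term) ⟩
        D ^ n * (e * (1# * (Q * Φ + 1#) ^ n + - 1# * (Q * Ψ + 1#) ^ n)
          + f * (1# * (Q * Φ - 1#) ^ n + - 1# * (Q * Ψ - 1#) ^ n))
          ≈⟨ solve 7 (λ d e f a b c g →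
               d :* (e :* (con (+ 1) :* a :+ :- con (+ 1) :* b) :+ f :* (con (+ 1) :* c :+ :- con (+ 1) :* g)) :=
               e :* (d :* a :- d :* b) :+ f :* (d :* c :- d :* g)) refl (D ^ n) e f _ _ _ _ ⟩
        e * (D ^ n * (Q * Φ + 1#) ^ n - D ^ n * (Q * Ψ + 1#) ^ n)
          + f * (D ^ n * (Q * Φ - 1#) ^ n - D ^ n * (Q * Ψ - 1#) ^ n)
          ≈⟨ +-cong (*-congˡ (+-cong (power A+P) (-‿cong (power A-P)))) (*-congˡ (+-cong (power B+P) (-‿cong (power B-P)))) ⟩
        e * ((A + P) ^ n - (A - P) ^ n) + f * ((B + P) ^ n - (B - P) ^ n) ∎
        where
        τ : ℕ → Carrier
        τ k = fromℕ (n C k) * Q ^ (k ∸ 1) * δ (n ∸ k) * F (2 *ℕ k) x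

        power : ∀ {y z} → y ≈ D * z → D ^ n * z ^ n ≈ y ^ n
        power y≈Dz = trans (sym (^-distrib-* D _ n)) (^-congˡ n (sym y≈Dz))

        1^n≈1 : ∀ n → 1# ^ n ≈ 1#
        1^n≈1 zero    = refl
        1^n≈1 (suc n) = trans (*-identityˡ _) (1^n≈1 n)

        term : ∀ k → k ≤ n → Q * t * τ k ≈
          fromℕ (n C k) * (1# ^ (n ∸ k) * (e + f * (- 1#) ^ (n ∸ k))) * (1# * (Q * Φ) ^ k + - 1# * (Q * Ψ) ^ k)
        term k _ = begin
          Q * t * τ k
            ≈⟨ solve 6 (λ Q t N q d F → Q :* t :* (N :* q :* d :* F) := N :* d :* (t :* (Q :* (q :* F))))
                 refl Q t N (Q ^ (k ∸ 1)) (δ (n ∸ k)) (F (2 *ℕ k) x) ⟩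
          N * δ (n ∸ k) * (t * (Q * (Q ^ (k ∸ 1) * F (2 *ℕ k) x)))
            ≈⟨ *-cong (*-congˡ (trans (δ≈ (n ∸ k)) (trans (sym (*-identityˡ _)) (*-congʳ (sym (1^n≈1 (n ∸ k)))))))
                 (*-congˡ (Q-power k)) ⟩
          N * (1# ^ (n ∸ k) * (e + f * (- 1#) ^ (n ∸ k))) * (t * (Q ^ k * F (2 *ℕ k) x))
            ≈⟨ *-congˡ (solve 3 (λ t q F → t :* (q :* F) := q :* (t :* F)) refl t (Q ^ k) (F (2 *ℕ k) x)) ⟩
          N * (1# ^ (n ∸ k) * (e + f * (- 1#) ^ (n ∸ k))) * (Q ^ k * (t * F (2 *ℕ k) x))
            ≈⟨ *-congˡ (*-congˡ (even-binet (λ m → F m x) F-binet k)) ⟩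
          N * (1# ^ (n ∸ k) * (e + f * (- 1#) ^ (n ∸ k))) * (Q ^ k * (1# * Φ ^ k + - 1# * Ψ ^ k))
            ≈⟨ *-congˡ (trans
                 (solve 3 (λ q a b → q :* (con (+ 1) :* a :+ :- con (+ 1) :* b) :=
                   con (+ 1) :* (q :* a) :+ :- con (+ 1) :* (q :* b)) refl (Q ^ k) (Φ ^ k) (Ψ ^ k))
                 (+-cong (*-congˡ (sym (^-distrib-* Q Φ k))) (*-congˡ (sym (^-distrib-* Q Ψ k))))) ⟩
          N * (1# ^ (n ∸ k) * (e + f * (- 1#) ^ (n ∸ k))) * (1# * (Q * Φ) ^ k + - 1# * (Q * Ψ) ^ k) ∎
          where
          N = fromℕ (n C k)

      -- The two identities.

      T-identity : ∀ n →
        x * (∑[ 0 ≤ k < n ] fromℕ (n C k) * P ^ᶻ (n ⊖ suc k) [ P#0 ]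
              * (1# - (- 1#) ^ (n ∸ k)) * T (2 *ℕ k) x)
        ≈ D ^ᶻ (n ⊖ 1) [ 2xs#0 ]
            * (∑[ 1 ≤ k < suc n ] fromℕ (n C k) * Q ^ (k ∸ 1)
              * (1# + (- 1#) ^ (n ∸ k)) * F (2 *ℕ k) x)
      T-identity n = *-cancelˡ-# (x#0y#0→xy#0 2#0 P#0) (begin
        fromℕ 2 * P * (x * (∑[ 0 ≤ k < n ] τ k))
          -- The term k = n completes the binomial range; its weight 1 - (- 1)^0 is zero.
          ≈⟨ *-congˡ (*-congˡ (sum-drop-last n τ τn≈0)) ⟩
        fromℕ 2 * P * (x * (∑[ 0 ≤ k < suc n ] τ k))
          ≈⟨ solve 3 (λ p x y → p :* (x :* y) := x :* (p :* y)) refl (fromℕ 2 * P) x _ ⟩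
        x * (fromℕ 2 * P * (∑[ 0 ≤ k < suc n ] τ k))
          ≈⟨ *-congˡ (P-sum n (λ k → T (2 *ℕ k) x) (even-binet (λ m → T m x) T-binet)) ⟩
        x * (1# * (1# * (A + P) ^ n + 1# * (B + P) ^ n) + - 1# * (1# * (A - P) ^ n + 1# * (B - P) ^ n))
          -- `P-sum` groups the four powers by the sign of `P`, whereas `Q-sum` groups them by `A`
          -- and `B`.
          ≈⟨ *-congˡ (solve 4 (λ a b c d →
               con (+ 1) :* (con (+ 1) :* a :+ con (+ 1) :* b) :+ :- con (+ 1) :* (con (+ 1) :* c :+ con (+ 1) :* d) :=
               con (+ 1) :* (a :- c) :+ con (+ 1) :* (b :- d)) refl _ _ _ _) ⟩
        x * (1# * ((A + P) ^ n - (A - P) ^ n) + 1# * ((B + P) ^ n - (B - P) ^ n))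
          ≈⟨ *-congˡ (Q-sum n 1# 1# (λ m → 1# + (- 1#) ^ m) (λ m → +-congˡ (sym (*-identityˡ _)))) ⟨
        x * (D ^ n * (Q * t * S))
          -- One `D` is split off D^n, also at n = 0, where the remaining power is the inverse of
          -- `D`.
          ≈⟨ *-congˡ (*-congʳ (^-⊖-suc D 2xs#0 {n} z≤n)) ⟨
        x * (D * Dz * (Q * t * S))
          ≈⟨ solve 6 (λ x d z q t S → x :* (d :* z :* (q :* t :* S)) := x :* (d :* (q :* t)) :* (z :* S))
               refl x D Dz Q t S ⟩
        x * (D * (Q * t)) * (Dz * S)
          ≈⟨ *-congʳ xDQt≈2P ⟩
        fromℕ 2 * P * (Dz * S) ∎)
        where
        τ : ℕ → Carrier
        τ k = fromℕ (n C k) * P ^ᶻ (n ⊖ suc k) [ P#0 ] * (1# - (- 1#) ^ (n ∸ k)) * T (2 *ℕ k) x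

        τn≈0 : τ n ≈ 0#
        τn≈0 rewrite ℕ.n∸n≡0 n = solve 3 (λ a b c → a :* b :* (con (+ 1) :- con (+ 1)) :* c := con (+ 0))
               refl _ _ _

        Dz S : Carrier
        Dz = D ^ᶻ (n ⊖ 1) [ 2xs#0 ]
        S  = ∑[ 1 ≤ k < suc n ] fromℕ (n C k) * Q ^ (k ∸ 1) * (1# + (- 1#) ^ (n ∸ k)) * F (2 *ℕ k) x

      U-identity : ∀ n →
        h * (∑[ 0 ≤ k < suc n ] fromℕ (n C k) * P ^ᶻ (n ⊖ suc k) [ P#0 ]
              * (1# - (- 1#) ^ (n ∸ k)) * U (2 *ℕ k) x)
        ≈ D ^ᶻ (n ⊖ 2) [ 2xs#0 ]
            * (∑[ 1 ≤ k < suc n ] fromℕ (n C k) * Q ^ (k ∸ 1)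
              * (α x s - (- 1#) ^ (n ∸ k) * β x s) * F (2 *ℕ k) x)
      U-identity n = *-cancelˡ-# (x#0y#0→xy#0 2#0 (x#0y#0→xy#0 (x#0y#0→xy#0 2#0 (*#0⇒#0ʳ [x³+2x]s#0)) P#0)) (begin
        fromℕ 2 * (fromℕ 2 * s * P) * (h * S′)
          -- The outer 2 is there to cancel `h`; what remains, 2sP, is the multiplier of `P-sum` for
          -- the factor 2s of `U-binet`.
          ≈⟨ solve 5 (λ s p h S w → w :* (con (+ 2) :* s :* p) :* (h :* S) := w :* h :* (con (+ 2) :* s :* p :* S))
                 refl s P h S′ (fromℕ 2) ⟩
        fromℕ 2 * h * (fromℕ 2 * s * P * S′)
          ≈⟨ trans (*-congʳ 2h≈1) (*-identityˡ _) ⟩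
        fromℕ 2 * s * P * S′
          ≈⟨ P-sum n (λ k → U (2 *ℕ k) x) (even-binet (λ m → U m x) U-binet) ⟩
        1# * (α x s * (A + P) ^ n + - β x s * (B + P) ^ n) + - 1# * (α x s * (A - P) ^ n + - β x s * (B - P) ^ n)
          ≈⟨ solve 6 (λ α β a b c d →
               con (+ 1) :* (α :* a :+ (:- β) :* b) :+ :- con (+ 1) :* (α :* c :+ (:- β) :* d) :=
               α :* (a :- c) :+ (:- β) :* (b :- d)) refl (α x s) (β x s) _ _ _ _ ⟩
        α x s * ((A + P) ^ n - (A - P) ^ n) + - β x s * ((B + P) ^ n - (B - P) ^ n)
          ≈⟨ Q-sum n (α x s) (- β x s) (λ m → α x s - (- 1#) ^ m * β x s)
               (λ m → solve 3 (λ α β ε → α :- ε :* β := α :+ (:- β) :* ε) refl (α x s) (β x s) ((- 1#) ^ m)) ⟨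
        D ^ n * (Q * t * S)
          ≈⟨ *-congʳ (^-⊖2 D 2xs#0 n) ⟨
        D * D * Dz * (Q * t * S)
          -- Only one of the two factors `D` is unfolded to 2xs: its `x` forms x D Q t with the
          -- other `D`, and its 2s joins the multiplier.
          ≈⟨ solve 6 (λ x s z q t S → let d = con (+ 2) :* x :* s in
               d :* d :* z :* (q :* t :* S) := con (+ 2) :* s :* (x :* (d :* (q :* t))) :* (z :* S))
               refl x s Dz Q t S ⟩
        fromℕ 2 * s * (x * (D * (Q * t))) * (Dz * S)
          ≈⟨ *-congʳ (*-congˡ xDQt≈2P) ⟩
        fromℕ 2 * s * (fromℕ 2 * P) * (Dz * S)
          ≈⟨ *-congʳ (solve 3 (λ w s p → w :* s :* (w :* p) := w :* (w :* s :* p)) refl (fromℕ 2) s P) ⟩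
        fromℕ 2 * (fromℕ 2 * s * P) * (Dz * S) ∎)
        where
        S′ Dz S : Carrier
        S′ = ∑[ 0 ≤ k < suc n ] fromℕ (n C k) * P ^ᶻ (n ⊖ suc k) [ P#0 ] * (1# - (- 1#) ^ (n ∸ k)) * U (2 *ℕ k) x
        Dz = D ^ᶻ (n ⊖ 2) [ 2xs#0 ]
        S  = ∑[ 1 ≤ k < suc n ] fromℕ (n C k) * Q ^ (k ∸ 1) * (α x s - (- 1#) ^ (n ∸ k) * β x s) * F (2 *ℕ k) x

    -- Admissibility away from the exceptional points.

    #⇒admissible : (i √2 : Carrier) → i ^ 2 ≈ - 1# → √2 ^ 2 ≈ fromℕ 2 → (√2#0 : √2 # 0#) →
      x # 0# → x # 1# → x # - 1# →
      x # 1# / √2 [ √2#0 ] → x # - (1# / √2 [ √2#0 ]) →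
      x # fromℕ 2 * i → x # - (fromℕ 2 * i) →
      x # i * √2 → x # - (i * √2) →
      Admissible x s t
    #⇒admissible i √2 i² √2² √2#0 x#0 x#1 x#-1 x#w x#-w x#2i x#-2i x#i√2 x#-i√2 = record
      { x²+2#0     = x²+2#0
      ; [x³+2x]s#0 = x#0y#0→xy#0
          (#-congʳ (solve 1 (λ x → x :* (x :^ 2 :+ con (+ 2)) := x :^ 3 :+ con (+ 2) :* x) refl x)
            (x#0y#0→xy#0 x#0 x²+2#0))
          s#0
      -- The numerator of `P` factors as t x (2x² - 1).
      ; P#0        = x#0y#0→xy#0
          (x#0y#0→xy#0 t#0
            (#-congʳ (solve 1 (λ x → x :* (con (+ 2) :* x :^ 2 :- con (+ 1)) := con (+ 2) :* x :^ 3 :- x)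
                   refl x)
              (x#0y#0→xy#0 x#0 2x²-1#0)))
          (inv#0 x²+2#0)
      ; 2xs#0      = x#0y#0→xy#0 (x#0y#0→xy#0 2#0 x#0) s#0
      }
      where
      w : Carrier
      w = 1# / √2 [ √2#0 ]

      -- The difference of squares factors as (x - y)(x + y). The values y = i√2, 1, 2i and 1/√2
      -- give x² + 2, s², t² and half of 2x² - 1, which is how the pairs of excluded points arise.
      #±⇒x²-y²#0 : ∀ {y} → x # y → x # - y → x ^ 2 - y ^ 2 # 0#
      #±⇒x²-y²#0 {y} x#y x#-y = #-congʳ
        (solve 2 (λ x y → (x :- y) :* (x :- :- y) := x :^ 2 :- y :^ 2) refl x y)
        (x#0y#0→xy#0 (#⇒-#0 x#y) (#⇒-#0 x#-y))

      x²+2#0 : x ^ 2 + fromℕ 2 # 0#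
      x²+2#0 = #-congʳ (modulo (- (√2 ^ 2)) i² (modulo 1# √2² (solve 3 (λ x i w →
          x :^ 2 :- (i :* w) :^ 2 := ((x :^ 2 :+ con (+ 2)) :+ :- (w :^ 2) :* (i :^ 2 :- :- con (+ 1)))
            :+ con (+ 1) :* (w :^ 2 :- con (+ 2))) refl x i √2)))
        (#±⇒x²-y²#0 x#i√2 x#-i√2)

      s#0 : s # 0#
      -- `s ^ 2` unfolds to `s * (s * 1#)`, so apartness passes from the square to its first factor.
      s#0 = *#0⇒#0ˡ (#-congʳ (trans (+-congˡ (-‿cong 1²)) (sym s²)) (#±⇒x²-y²#0 x#1 x#-1))
        where
        1² : 1# ^ 2 ≈ 1#
        1² = solve 0 (con (+ 1) :^ 2 := con (+ 1)) refl

      t#0 : t # 0#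
      t#0 = *#0⇒#0ˡ (#-congʳ (trans
          (modulo (- fromℕ 4) i² (solve 2 (λ x i →
            x :^ 2 :- (con (+ 2) :* i) :^ 2 := (x :^ 2 :+ con (+ 4)) :+ :- con (+ 4) :* (i :^ 2 :- :- con (+ 1)))
                   refl x i))
          (sym t²))
        (#±⇒x²-y²#0 x#2i x#-2i))

      2w²≈1 : fromℕ 2 * w ^ 2 ≈ 1#
      2w²≈1 = begin
        fromℕ 2 * w ^ 2     ≈⟨ *-congʳ √2² ⟨
        √2 ^ 2 * w ^ 2      ≈⟨ solve 2 (λ a v → a :^ 2 :* (con (+ 1) :* v) :^ 2 := (a :* v) :^ 2)
               refl √2 (inv √2 √2#0) ⟩
        (√2 * inv √2 √2#0) ^ 2 ≈⟨ ^-congˡ 2 (inv-inverseʳ √2#0) ⟩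
        1# ^ 2              ≈⟨ solve 0 (con (+ 1) :^ 2 := con (+ 1)) refl ⟩
        1#                  ∎

      2x²-1#0 : fromℕ 2 * x ^ 2 - 1# # 0#
      2x²-1#0 = #-congʳ (modulo (- 1#) 2w²≈1 (solve 2 (λ x w →
          con (+ 2) :* (x :^ 2 :- w :^ 2) :=
          (con (+ 2) :* x :^ 2 :- con (+ 1)) :+ :- con (+ 1) :* (con (+ 2) :* w :^ 2 :- con (+ 1))) refl x w))
        (x#0y#0→xy#0 2#0 (#±⇒x²-y²#0 x#w x#-w))

-- Specialisation to the complex numbers.

open Complex using (ℂ; i; fromℚ; ℂ-heytingField)
open HeytingField ℂ-heytingField using (_≈_; _#_; _+_; _*_; _-_; -_; 0#; 1#)
open Field ℂ-heytingField

-- All Cauchy sequences involved are constant, so the components agree termwise by computation with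
-- closed rationals.
2*½≈1 : fromℕ 2 * fromℚ ½ ≈ 1#
2*½≈1 = Complex.≗⇒≈ (λ _ → ≡.refl) (λ _ → ≡.refl)

i²≈-1 : i ^ 2 ≈ - 1#
i²≈-1 = Complex.≗⇒≈ (λ _ → ≡.refl) (λ _ → ≡.refl)

theorem7 : (x s t : ℂ) → s ^ 2 ≈ x ^ 2 - 1# → t ^ 2 ≈ x ^ 2 + fromℕ 4 →
    ((n : ℕ) (admissible : Admissible x s t) → let open Admissible admissible in
    (x * (∑[ 0 ≤ k < n ] fromℕ (n C k) * P ^ᶻ (n ⊖ suc k) [ P#0 ]
    * (1# - (- 1#) ^ (n ∸ k)) * T (2 *ℕ k) x)
    ≈ (fromℕ 2 * x * s) ^ᶻ (n ⊖ 1) [ 2xs#0 ]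
    * (∑[ 1 ≤ k < suc n ] fromℕ (n C k) * Q ^ (k ∸ 1)
    * (1# + (- 1#) ^ (n ∸ k)) * F (2 *ℕ k) x))
    ×
    (fromℚ ½ * (∑[ 0 ≤ k < suc n ] fromℕ (n C k) * P ^ᶻ (n ⊖ suc k) [ P#0 ]
    * (1# - (- 1#) ^ (n ∸ k)) * U (2 *ℕ k) x)
    ≈ (fromℕ 2 * x * s) ^ᶻ (n ⊖ 2) [ 2xs#0 ]
    * (∑[ 1 ≤ k < suc n ] fromℕ (n C k) * Q ^ (k ∸ 1)
    * (α x s - (- 1#) ^ (n ∸ k) * β x s) * F (2 *ℕ k) x)))
    ×
    ((√2 : ℂ) → √2 ^ 2 ≈ fromℕ 2 → (√2#0 : √2 # 0#) →
    x # 0# → x # 1# → x # - 1# →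
    x # 1# / √2 [ √2#0 ] → x # - (1# / √2 [ √2#0 ]) →
    x # fromℕ 2 * i → x # - (fromℕ 2 * i) →
    x # i * √2 → x # - (i * √2) →
    Admissible x s t)
theorem7 x s t s² t² =
  (λ n admissible → T-identity admissible n , U-identity admissible n) , λ √2 → #⇒admissible i √2 i²≈-1
  where open ChebyshevFibonacci.Identities ℂ-heytingField (fromℚ ½) 2*½≈1 x s t s² t²
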